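{- For every integer $l\ge 2$, $$(1+o(1))\left(\frac{m}{2l+1}\right)^{(2l+1)/2}\le \rho(C_{2l+1},m)\le \frac{(2l+1)^{l-1/2}}{2\,(l-1)^{(l-1)(2l+1)/(2l)}}\left(\frac{m}{2l+1}\right)^{(2l+1)/2},$$ where the upper bound holds for every positive integer $m$, and in the lower bound $o(1)$ denotes a quantity tending to $0$ as $m\to\infty$ with $l$ fixed.
   Context: Graphs are finite, simple and undirected. $C_k$ denotes the cycle on $k$ vertices. For graphs $G$ and $H$, $c(G,H)$ is the number of induced copies of $H$ in $G$, i.e. the number of subsets $S\subseteq V(G)$ such that the induced subgraph $G[S]$ is isomorphic to $H$. For a positive integer $m$, $\rho(H,m)=\max\{c(G,H) : G \text{ a graph with } |E(G)|=m\}$ (the number of vertices of $G$ is not restricted). -}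

module Defs where

open import Data.Fin.Base using (Fin; toℕ)
import Data.Fin.Properties as Fin
open import Data.Fin.Subset using (Subset; inside; outside; _∈_)
open import Data.Fin.Subset.Properties using (_∈?_)
open import Data.Integer.Base using (+_)
open import Data.List.Base using (List; []; _∷_; _++_; map; filter; length; allFin; cartesianProduct)
open import Data.Nat.Base using (ℕ; zero; suc; _∸_; NonZero; NonTrivial; nonTrivial⇒nonZero; _≥_)
  renaming (_*_ to _*ℕ_; _≤_ to _≤ℕ_)
import Data.Nat.Properties as ℕ
open import Data.Product.Base using (Σ-syntax; ∃; ∃-syntax; _×_; _,_; proj₁; proj₂)
open import Data.Rational.Base 
  using (ℚ; 0ℚ; NonNegative; Positive; _*_; 1/_; _/_; _≤_; _<_; ∣_∣)
  renaming (NonZero to ℚNonZero)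
import Data.Rational.Properties as ℚ
open import Data.Sum.Base using (_⊎_; swap)
open import Data.Vec.Base using (Vec; []; _∷_; lookup; tabulate)
open import Data.Vec.Properties using (lookup∘tabulate)
open import Data.Vec.Properties.WithK using ([]=-irrelevant)
open import Function.Bundles using (_↔_; _⇔_; Inverse; Equivalence; mk↔ₛ′; mk⇔)
open import Relation.Binary.Core using (Rel)
open import Relation.Binary.Definitions using (Decidable; Symmetric)
open import Relation.Binary.PropositionalEquality
  using (_≡_; _≢_; refl; sym; trans; cong; subst; subst₂; ≢-sym)
open import Relation.Nullary.Decidable using (Dec; map′; _×-dec_; _⊎-dec_; _→-dec_; ¬?)
open import Relation.Nullary.Negation using (¬_)
open import Algebra.Definitions.RawSemiring ℚ.+-*-rawSemiring using (_^_)
open import Level using (0ℓ)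

record SimpleGraph (V : Set) : Set₁ where
  infix 4 _~_ _~?_
  field
    _~_      : Rel V 0ℓ
    _~?_     : Decidable _~_
    ~-sym    : Symmetric _~_
    ~-irrefl : ∀ {v} → ¬ (v ~ v)

open SimpleGraph using (~-sym; ~-irrefl)

record _≅_ {V W : Set} (G : SimpleGraph V) (H : SimpleGraph W) : Set where
  private
    module G = SimpleGraph G
    module H = SimpleGraph H
  field
    bijection : V ↔ W
    adjacency : ∀ u v → (u G.~ v) ⇔ (Inverse.to bijection u H.~ Inverse.to bijection v)

induced : ∀ {n} → SimpleGraph (Fin n) → (S : Subset n) → SimpleGraph (∃[ v ] v ∈ S)
induced G S = record
  { _~_      = λ u v → proj₁ u G.~ proj₁ v
  ; _~?_     = λ u v → proj₁ u G.~? proj₁ v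
  ; ~-sym    = ~-sym G
  ; ~-irrefl = ~-irrefl G
  }
  where module G = SimpleGraph G

∣E_∣ : ∀ {n} → SimpleGraph (Fin n) → ℕ
∣E_∣ {n} G =
  length (filter (λ (u , v) → (u Fin.<? v) ×-dec (u ~? v))
                 (cartesianProduct (allFin n) (allFin n)))
  where open SimpleGraph G

Next : ∀ {k} → Rel (Fin k) 0ℓ
Next {k} i j = toℕ j ≡ suc (toℕ i) ⊎ (suc (toℕ i) ≡ k × toℕ j ≡ 0)

-- For k ≥ 3 this is the cycle on k vertices.  The condition i ≢ j matters only
-- for k = 1, where it excludes a loop.
C : (k : ℕ) → SimpleGraph (Fin k)
C k = record
  { _~_      = λ i j → i ≢ j × (Next i j ⊎ Next j i)
  ; _~?_     = λ i j → ¬? (i Fin.≟ j) ×-dec (next? i j ⊎-dec next? j i)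
  ; ~-sym    = λ (i≢j , p) → ≢-sym i≢j , swap p
  ; ~-irrefl = λ (i≢i , _) → i≢i refl
  }
  where
  next? : Decidable (Next {k})
  next? i j = (toℕ j ℕ.≟ suc (toℕ i)) ⊎-dec ((suc (toℕ i) ℕ.≟ k) ×-dec (toℕ j ℕ.≟ 0))

any-Vec? : ∀ {n} k {P : Vec (Fin n) k → Set} → (∀ xs → Dec (P xs)) → Dec (∃ P)
any-Vec? zero    P? = map′ ([] ,_) (λ { ([] , p) → p }) (P? [])
any-Vec? (suc k) P? =
  map′ (λ (x , xs , p) → x ∷ xs , p) (λ { (x ∷ xs , p) → x , xs , p })
       (Fin.any? λ x → any-Vec? k λ xs → P? (x ∷ xs))

private
  module _ {n k} (G : SimpleGraph (Fin n)) (S : Subset n) (H : SimpleGraph (Fin k)) where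
    private
      module G = SimpleGraph G
      module H = SimpleGraph H

    IsCopy : Vec (Fin n) k → Set
    IsCopy f =
        (∀ a → lookup f a ∈ S)
      × (∀ v → v ∈ S → ∃[ a ] lookup f a ≡ v)
      × (∀ a b → lookup f a ≡ lookup f b → a ≡ b)
      × (∀ a b → (lookup f a G.~ lookup f b → a H.~ b) × (a H.~ b → lookup f a G.~ lookup f b))

    isCopy? : ∀ f → Dec (IsCopy f)
    isCopy? f =
            Fin.all? (λ a → lookup f a ∈? S)
      ×-dec Fin.all? (λ v → (v ∈? S) →-dec Fin.any? (λ a → lookup f a Fin.≟ v))
      ×-dec Fin.all? (λ a → Fin.all? λ b → (lookup f a Fin.≟ lookup f b) →-dec (a Fin.≟ b))
      ×-dec Fin.all? (λ a → Fin.all? λ b →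
                 ((lookup f a G.~? lookup f b) →-dec (a H.~? b))
           ×-dec ((a H.~? b) →-dec (lookup f a G.~? lookup f b)))

    ≡-subtype : ∀ {x y : ∃[ v ] v ∈ S} → proj₁ x ≡ proj₁ y → x ≡ y
    ≡-subtype {v , p} {_ , q} refl = cong (v ,_) ([]=-irrelevant p q)

    copy⇒≅ : ∃ IsCopy → induced G S ≅ H
    copy⇒≅ (f , f∈S , onto , inj , adj) = record
      { bijection = mk↔ₛ′ to from
          (λ a → inj _ _ (proj₂ (onto (lookup f a) (f∈S a))))
          (λ (v , v∈S) → ≡-subtype (proj₂ (onto v v∈S)))
      ; adjacency = λ (u , u∈S) (v , v∈S) →
          let a , fa≡u = onto u u∈S
              b , fb≡v = onto v v∈S
          in mk⇔ (λ u~v → proj₁ (adj a b) (subst₂ G._~_ (sym fa≡u) (sym fb≡v) u~v))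
                 (λ a~b → subst₂ G._~_ fa≡u fb≡v (proj₂ (adj a b) a~b))
      }
      where
      to : ∃[ v ] v ∈ S → Fin k
      to (v , v∈S) = proj₁ (onto v v∈S)

      from : Fin k → ∃[ v ] v ∈ S
      from a = lookup f a , f∈S a

    ≅⇒copy : induced G S ≅ H → ∃ IsCopy
    ≅⇒copy iso =
        tabulate g
      , (λ a → subst (_∈ S) (sym (eq a)) (proj₂ (from a)))
      , (λ v v∈S → to (v , v∈S) , trans (eq _) (cong proj₁ (strictlyInverseʳ (v , v∈S))))
      , (λ a b e → g-injective (trans (sym (eq a)) (trans e (eq b))))
      , (λ a b →
            (λ p → g-reflects (subst₂ G._~_ (eq a) (eq b) p))
          , (λ p → subst₂ G._~_ (sym (eq a)) (sym (eq b)) (g-preserves p)))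
      where
      open _≅_ iso
      open Inverse bijection

      g : Fin k → Fin n
      g a = proj₁ (from a)

      eq : ∀ a → lookup (tabulate g) a ≡ g a
      eq = lookup∘tabulate g

      g-injective : ∀ {a b} → g a ≡ g b → a ≡ b
      g-injective {a} {b} e =
        trans (sym (strictlyInverseˡ a)) (trans (cong to (≡-subtype e)) (strictlyInverseˡ b))

      g-reflects : ∀ {a b} → g a G.~ g b → a H.~ b
      g-reflects {a} {b} p =
        subst₂ H._~_ (strictlyInverseˡ a) (strictlyInverseˡ b)
          (Equivalence.to (adjacency (from a) (from b)) p)

      g-preserves : ∀ {a b} → a H.~ b → g a G.~ g b
      g-preserves {a} {b} p =
        Equivalence.from (adjacency (from a) (from b))
          (subst₂ H._~_ (sym (strictlyInverseˡ a)) (sym (strictlyInverseˡ b)) p)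

induced≅? : ∀ {n k} (G : SimpleGraph (Fin n)) (H : SimpleGraph (Fin k)) →
            ∀ S → Dec (induced G S ≅ H)
induced≅? {k = k} G H S = map′ (copy⇒≅ G S H) (≅⇒copy G S H) (any-Vec? k (isCopy? G S H))

allSubsets : ∀ n → List (Subset n)
allSubsets zero    = [] ∷ []
allSubsets (suc n) = map (inside ∷_) (allSubsets n) ++ map (outside ∷_) (allSubsets n)

c : ∀ {n k} → SimpleGraph (Fin n) → SimpleGraph (Fin k) → ℕ
c {n} G H = length (filter (induced≅? G H) (allSubsets n))

-- ρ[ H , m ]≡ r states that r = max { c(G,H) : |E(G)| = m }, with G ranging over
-- the finite graphs on any number of vertices.
record ρ[_,_]≡_ {k} (H : SimpleGraph (Fin k)) (m r : ℕ) : Set₁ where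
  field
    attained   : ∃[ n ] Σ[ G ∈ SimpleGraph (Fin n) ] (∣E G ∣ ≡ m × c G H ≡ r)
    upperBound : ∀ {n} (G : SimpleGraph (Fin n)) → ∣E G ∣ ≡ m → c G H ≤ℕ r

^-nonNeg : ∀ p .{{_ : NonNegative p}} n → NonNegative (p ^ n)
^-nonNeg p zero    = _
^-nonNeg p (suc n) = ℚ.nonNeg*nonNeg⇒nonNeg p (p ^ n) {{^-nonNeg p n}}

^-pos : ∀ p .{{_ : Positive p}} n → Positive (p ^ n)
^-pos p zero    = _
^-pos p (suc n) = ℚ.pos*pos⇒pos p (p ^ n) {{^-pos p n}}

-- The library has no real numbers.  The ones needed here are all of the form
-- q^(1/d) with q ≥ 0 rational and d ≥ 1, a class closed under products,
-- quotients and rational powers.  The order below is the order of the real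
-- numbers represented (x ≤ y if and only if x^(d e) ≤ y^(d e), for x, y ≥ 0),
-- so two records may represent the same number.
infix 8 √[_]_
record Radical : Set where
  constructor √[_]_
  field
    index                : ℕ
    radicand             : ℚ
    .{{index-nonZero}}   : NonZero index
    .{{radicand-nonNeg}} : NonNegative radicand

open Radical using (radicand)

infix 4 _≤ᴿ_
_≤ᴿ_ : Rel Radical 0ℓ
√[ d ] p ≤ᴿ √[ e ] q = p ^ e ≤ q ^ d

infixl 7 _·_ _÷_
_·_ : Radical → Radical → Radical
√[ d ] p · √[ e ] q =
  (√[ d *ℕ e ] (p ^ e * q ^ d))
    {{ℕ.m*n≢0 d e}}
    {{ℚ.nonNeg*nonNeg⇒nonNeg (p ^ e) {{^-nonNeg p e}} (q ^ d) {{^-nonNeg q d}}}}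

Positiveᴿ : Radical → Set
Positiveᴿ x = Positive (radicand x)

_⁻¹ : (x : Radical) .{{_ : Positiveᴿ x}} → Radical
(√[ d ] p) ⁻¹ = √[ d ] (1/ p)
  where instance
    p≢0 : ℚNonZero p
    p≢0 = ℚ.pos⇒nonZero p

    1/p≥0 : NonNegative (1/ p)
    1/p≥0 = ℚ.pos⇒nonNeg (1/ p) {{ℚ.1/pos⇒pos p}}

_÷_ : (x y : Radical) .{{_ : Positiveᴿ y}} → Radical
x ÷ y = x · y ⁻¹

-- The exponent is the fraction a/b.
infix 9 _^[_/_]
_^[_/_] : Radical → (a b : ℕ) .{{_ : NonZero b}} → Radical
(√[ d ] p) ^[ a / b ] = (√[ d *ℕ b ] (p ^ a)) {{ℕ.m*n≢0 d b}} {{^-nonNeg p a}}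

rational : (q : ℚ) .{{_ : NonNegative q}} → Radical
rational q = √[ 1 ] q

natural : ℕ → Radical
natural n = rational (+ n / 1) {{ℚ.normalize-nonNeg n 1}}

natural-pos : ∀ n .{{_ : NonZero n}} → Positiveᴿ (natural n)
natural-pos n = ℚ.normalize-pos n 1

·-pos : ∀ x y .{{_ : Positiveᴿ x}} .{{_ : Positiveᴿ y}} → Positiveᴿ (x · y)
·-pos (√[ d ] p) (√[ e ] q) =
  ℚ.pos*pos⇒pos (p ^ e) {{^-pos p e}} (q ^ d) {{^-pos q d}}

^-posᴿ : ∀ x a b .{{_ : NonZero b}} .{{_ : Positiveᴿ x}} → Positiveᴿ (x ^[ a / b ])
^-posᴿ (√[ d ] p) a b = ^-pos p a

-- (m / (2l+1))^((2l+1)/2)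
mainTerm : ℕ → ℕ → Radical
mainTerm l m =
  rational (+ m / suc (2 *ℕ l)) {{ℚ.normalize-nonNeg m (suc (2 *ℕ l))}} ^[ suc (2 *ℕ l) / 2 ]

-- (2l+1)^(l-1/2) / (2 (l-1)^((l-1)(2l+1)/(2l))), with l - 1/2 written (2l-1)/2;
-- NonTrivial l says l ≥ 2.
upperConstant : (l : ℕ) .{{_ : NonTrivial l}} → Radical
upperConstant l = natural (suc (2 *ℕ l)) ^[ 2 *ℕ l ∸ 1 / 2 ] ÷ (natural 2 · power)
  where
  l-1≢0 : ∀ l .{{_ : NonTrivial l}} → NonZero (l ∸ 1)
  l-1≢0 (suc (suc _)) = _

  instance
    2l≢0 : NonZero (2 *ℕ l)
    2l≢0 = ℕ.m*n≢0 2 l {{_}} {{nonTrivial⇒nonZero l}}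

  power : Radical
  power = natural (l ∸ 1) ^[ (l ∸ 1) *ℕ suc (2 *ℕ l) / 2 *ℕ l ]

  instance
    divisor-pos : Positiveᴿ (natural 2 · power)
    divisor-pos = ·-pos (natural 2) power {{natural-pos 2}}
      {{^-posᴿ (natural (l ∸ 1)) ((l ∸ 1) *ℕ suc (2 *ℕ l)) (2 *ℕ l) {{2l≢0}}
          {{natural-pos (l ∸ 1) {{l-1≢0 l}}}}}}

infix 4 _⟶0
_⟶0 : (ℕ → ℚ) → Set
δ ⟶0 = ∀ ε → 0ℚ < ε → ∃[ M ] ∀ m → m ≥ M → ∣ δ m ∣ < ε

module Submission where

-- Upper bound, with k = 2l+1.  Let N count the k-tuples of vertices that traverse an induced
-- k-cycle, 2k for each copy, and P the 2l-tuples that traverse an induced path.  Deleting a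
-- coordinate of a cycle leaves a path, so N^(2l) ≤ P^k by Loomis–Whitney.  Such a path is determined
-- by its edges x₁x₂, x₃x₄, …, and once an edge is chosen the edges that may come next are disjoint
-- from those that may come later; hence the edges after the first are drawn from l-1 disjoint sets,
-- and AM–GM gives P ≤ m (m/(l-1))^(l-1).
--
-- Lower bound.  Let s = ⌊√(m/k)⌋.  Replacing each vertex of C_k by s independent copies uses k s² ≤ m
-- edges and creates s^k induced k-cycles; the remaining edges are added disjointly.  As
-- m/k < (s+1)², the choice 1+δ = (s/(s+1))^k works, and |δ| ≤ k/(s+1) by Bernoulli.

-- Why paths at all: the 2l vertices of a path split into l disjoint edges, while an odd cycle has
-- no such splitting; Loomis-Whitney passes from the odd to the even case. Where the constant comes
-- from: with r copies, N ≥ 2kr and the two estimates give (2kr)^(2l) (l-1)^((l-1)k) ≤ m^(lk). The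
-- 2l-th root is the claimed bound, because k^(k/2) / (2k) = k^(l-1/2) / 2. Where factors of 2 are
-- saved: N and P count ordered tuples, and m edges have 2m orientations. A tuple that continues an
-- edge xy does so from only one of its ends, so the first edge costs m. Each later edge has exactly
-- one end attached to its predecessor, which fixes its orientation. The l-1 disjoint sets vary with
-- the path chosen so far. AM-GM is therefore not applied once to l-1 numbers but in its weighted
-- two-term form at every step of an induction. Fractional powers are kept out of the counting: all
-- estimates, Hölder included, compare integer powers of natural numbers with denominators cleared,
-- and radicals enter only at the end.

module Counting where

  open import Defs using (SimpleGraph; _≅_; induced; ∣E_∣; Next; C; induced≅?; allSubsets; c; ρ[_,_]≡_)
  open import Data.Bool.Base using (Bool; true; false; T; not; _∧_; _∨_)
  open import Data.Bool.ListAction using (all)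
  import Data.Bool.Properties as Bool
  open import Data.Bool.Properties using (T-∧; T-∨; T-≡)
  open import Data.Fin.Base using (Fin; zero; suc; toℕ; combine; quotient; opposite; _↑ˡ_; _↑ʳ_)
  import Data.Fin.Properties as Fin
  import Data.Fin.Subset as Subset
  open import Data.Fin.Subset using (Subset; inside; outside)
  import Data.List.Base as List
  open import Data.List.Base
    using (List; []; _∷_; _++_; length; take; drop; filter; tabulate; allFin; applyUpTo; cartesianProduct; cartesianProductWith)
  import Data.List.Membership.DecPropositional as DecMembership
  open import Data.List.Membership.Propositional using (_∈_)
  open import Data.List.Membership.Propositional.Properties
    using (∈-map⁺; ∈-map⁻; ∈-++⁺ˡ; ∈-++⁺ʳ; ∈-++⁻; ∈-applyUpTo⁻; ∈-filter⁺; ∈-filter⁻; ∈-lookup)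
  import Data.List.Properties as List
  open import Data.List.Relation.Binary.Subset.Propositional using (_⊆_)
  import Data.List.Relation.Unary.All as All
  open import Data.List.Relation.Unary.AllPairs using ([]; _∷_)
  open import Data.List.Relation.Unary.Any using (here; there; index)
  open import Data.List.Relation.Unary.Any.Properties using (lookup-index)
  open import Data.List.Relation.Unary.Unique.Propositional using (Unique)
  import Data.List.Relation.Unary.Unique.Propositional.Properties as Unique
  open import Data.Nat.Base
  open import Data.Nat.DivMod using (_mod_; m%n<n; %-distribˡ-+; m<n⇒m%n≡m; n%n≡0; [m+n]%n≡m%n)
  open import Data.Nat.Properties
  open import Data.Nat.Tactic.RingSolver using (solve-∀)
  open import Data.Product.Base using (_×_; _,_; proj₁; proj₂; ∃-syntax; Σ-syntax)
  import Data.Sum.Base as Sum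
  open import Data.Sum.Base using (inj₁; inj₂; [_,_]′; swap)
  open import Data.Unit.Base using (tt)
  import Data.Vec.Base as Vec
  open import Data.Vec.Base using (Vec; []; _∷_; lookup)
  import Data.Vec.Properties as Vec
  open import Data.Vec.Properties.WithK using ([]=-irrelevant)
  open import Function.Base using (_∘_; flip)
  open import Function.Bundles using (_⇔_; Inverse; Equivalence; mk⇔; mk↔ₛ′)
  open import Relation.Binary.Definitions using (Decidable; DecidableEquality; tri<; tri≈; tri>)
  open import Relation.Binary.PropositionalEquality
  open import Relation.Nullary.Decidable using (Dec; yes; no; does; dec-true; dec-false; does-⇔; _×-dec_; _⊎-dec_)
  open import Relation.Nullary.Negation using (contradiction; ¬_)
  import Relation.Unary as Unary
  open import Algebra.Properties.Semiring.Sum +-*-semiring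
    using (sum; ∑-comm; ∑-distrib-+; sum-cong-≗; *-distribˡ-sum; *-distribʳ-sum; sum-replicate-zero)
  open import Algebra.Properties.CommutativeMonoid.Sum *-1-commutativeMonoid
    using () renaming (sum to ∏; sum-cong-≗ to ∏-cong)

  -- AM–GM, Hölder and Loomis–Whitney

  ^-distribʳ-* : ∀ n x y → (x * y) ^ n ≡ x ^ n * y ^ n
  ^-distribʳ-* zero    x y = refl
  ^-distribʳ-* (suc n) x y =
    trans (cong (x * y *_) (^-distribʳ-* n x y)) ([m*n]*[o*p]≡[m*o]*[n*p] x y (x ^ n) (y ^ n))

  2xy≤x²+y² : ∀ x y → 2 * (x * y) ≤ x * x + y * y
  2xy≤x²+y² x y with ≤-total x y
  ... | inj₁ x≤y with m≤n⇒∃[o]m+o≡n x≤y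
  ... | d , refl = subst (2 * (x * (x + d)) ≤_) (eq x d) (m≤m+n _ (d * d))
    where
    eq : ∀ x d → 2 * (x * (x + d)) + d * d ≡ x * x + (x + d) * (x + d)
    eq = solve-∀
  2xy≤x²+y² x y | inj₂ y≤x with m≤n⇒∃[o]m+o≡n y≤x
  ... | d , refl = subst (2 * ((y + d) * y) ≤_) (eq y d) (m≤m+n _ (d * d))
    where
    eq : ∀ y d → 2 * ((y + d) * y) + d * d ≡ (y + d) * (y + d) + y * y
    eq = solve-∀

  -- The graph of x ↦ x^(1+j) lies above its tangent at s.
  tangent-≤ : ∀ j s x → suc j * (s ^ j * x) ≤ x ^ suc j + j * s ^ suc j
  tangent-≤ zero    s x = ≤-reflexive (eq x)
    where
    eq : ∀ x → 1 * (1 * x) ≡ x * 1 + 0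
    eq = solve-∀
  -- The cancelled term is what the inductive hypothesis, multiplied by `x`, leaves over. With it
  -- the left side becomes a multiple of `2 * (s * x)`.
  tangent-≤ (suc j) s x = +-cancelʳ-≤ (j * (s ^ suc j * x)) _ _ (begin
    suc (suc j) * (s ^ suc j * x) + j * (s ^ suc j * x)  ≡⟨ eq₁ j s (s ^ j) x ⟩
    (suc j * s ^ j) * (2 * (s * x))                      ≤⟨ *-monoʳ-≤ (suc j * s ^ j) (2xy≤x²+y² s x) ⟩
    (suc j * s ^ j) * (s * s + x * x)                    ≡⟨ eq₂ j s (s ^ j) x ⟩
    x * (suc j * (s ^ j * x)) + suc j * s ^ suc (suc j)  ≤⟨ +-monoˡ-≤ _ (*-monoʳ-≤ x (tangent-≤ j s x)) ⟩
    x * (x ^ suc j + j * s ^ suc j) + suc j * s ^ suc (suc j) ≡⟨ eq₃ j s (s ^ j) x (x ^ j) ⟩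
    x ^ suc (suc j) + suc j * s ^ suc (suc j) + j * (s ^ suc j * x) ∎)
    where
    open ≤-Reasoning
    eq₁ : ∀ j s p x → suc (suc j) * (s * p * x) + j * (s * p * x) ≡ (suc j * p) * (2 * (s * x))
    eq₁ = solve-∀
    eq₂ : ∀ j s p x → (suc j * p) * (s * s + x * x) ≡ x * (suc j * (p * x)) + suc j * (s * (s * p))
    eq₂ = solve-∀
    eq₃ : ∀ j s p x q → x * (x * q + j * (s * p)) + suc j * (s * (s * p))
                      ≡ x * (x * q) + suc j * (s * (s * p)) + j * (s * p * x)
    eq₃ = solve-∀

  -- The weighted AM–GM inequality a (b/j)^j ≤ ((a+b)/(1+j))^(1+j).
  am-gm : ∀ j a b → suc j ^ suc j * (a * b ^ j) ≤ j ^ j * (a + b) ^ suc j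
  am-gm zero a b = ≤-trans (≤-reflexive (eq₁ a)) (≤-trans (m≤m+n a b) (≤-reflexive (eq₂ (a + b))))
    where
    eq₁ : ∀ a → 1 * (a * 1) ≡ a
    eq₁ = solve-∀
    eq₂ : ∀ a → a ≡ 1 * (a * 1)
    eq₂ = solve-∀
  am-gm j@(suc _) a b = *-cancelˡ-≤ j (+-cancelʳ-≤ (j * s ^ suc j) _ _ (begin
    j * (suc j ^ suc j * (a * b ^ j)) + j * s ^ suc j
      ≡⟨ cong (λ z → j * (suc j ^ suc j * (a * b ^ j)) + j * z) (^-distribʳ-* (suc j) (suc j) b) ⟩
    j * (suc j ^ suc j * (a * b ^ j)) + j * (suc j ^ suc j * b ^ suc j)
      ≡⟨ eq₁ j (suc j ^ j) a b (b ^ j) ⟩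
    suc j * (suc j ^ j * b ^ j * (j * (a + b)))
      ≡⟨ cong (λ z → suc j * (z * (j * (a + b)))) (^-distribʳ-* j (suc j) b) ⟨
    suc j * (s ^ j * (j * (a + b)))
      ≤⟨ tangent-≤ j s (j * (a + b)) ⟩
    (j * (a + b)) ^ suc j + j * s ^ suc j
      ≡⟨ cong (_+ j * s ^ suc j) (trans (^-distribʳ-* (suc j) j (a + b)) (*-assoc j (j ^ j) _)) ⟩
    j * (j ^ j * (a + b) ^ suc j) + j * s ^ suc j ∎))
    where
    open ≤-Reasoning
    -- Equality in AM-GM holds for `j * a = b`, that is, for `j * (a + b) = s`; the tangent is
    -- therefore taken at `s`.
    s = suc j * b
    eq₁ : ∀ j p a b q → j * (suc j * p * (a * q)) + j * (suc j * p * (b * q)) ≡ suc j * (p * q * (j * (a + b)))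
    eq₁ = solve-∀

  n^n≢0 : ∀ n → NonZero (n ^ n)
  n^n≢0 zero    = _
  n^n≢0 (suc n) = m^n≢0 (suc n) (suc n)

  -- weight a b is Σᵢ aᵢ Πⱼ≠ᵢ (aⱼ + bⱼ).
  weight : ∀ {d} → (a b : Fin d → ℕ) → ℕ
  weight {zero}  a b = 0
  weight {suc d} a b =
    a zero * ∏ (λ i → a (suc i) + b (suc i)) + (a zero + b zero) * weight (a ∘ suc) (b ∘ suc)

  -- Adding the i-th summands of the two weights restores the factor aᵢ + bᵢ, so each of the d
  -- summands becomes the full product.
  weight-+ : ∀ {d} (a b : Fin d → ℕ) → weight a b + weight b a ≡ d * ∏ (λ i → a i + b i)
  weight-+ {zero}  a b = refl
  weight-+ {suc d} a b = begin
    (a zero * W + (a zero + b zero) * U) + (b zero * W′ + (b zero + a zero) * V)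
      ≡⟨ cong (λ z → (a zero * W + (a zero + b zero) * U) + (b zero * z + (b zero + a zero) * V)) (∏-comm a b) ⟩
    (a zero * W + (a zero + b zero) * U) + (b zero * W + (b zero + a zero) * V)
      ≡⟨ eq (a zero) (b zero) W U V ⟩
    (a zero + b zero) * W + (a zero + b zero) * (U + V)
      ≡⟨ cong (λ z → (a zero + b zero) * W + (a zero + b zero) * z) (weight-+ (a ∘ suc) (b ∘ suc)) ⟩
    (a zero + b zero) * W + (a zero + b zero) * (d * W)
      ≡⟨ eq′ (a zero + b zero) W d ⟩
    suc d * ((a zero + b zero) * W) ∎
    where
    open ≡-Reasoning
    W  = ∏ (λ i → a (suc i) + b (suc i))
    W′ = ∏ (λ i → b (suc i) + a (suc i))
    U  = weight (a ∘ suc) (b ∘ suc)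
    V  = weight (b ∘ suc) (a ∘ suc)
    ∏-comm : (a b : Fin (suc d) → ℕ) → ∏ (λ i → b (suc i) + a (suc i)) ≡ ∏ (λ i → a (suc i) + b (suc i))
    ∏-comm a b = ∏-cong (λ i → +-comm (b (suc i)) (a (suc i)))
    eq : ∀ a b W U V → (a * W + (a + b) * U) + (b * W + (b + a) * V) ≡ (a + b) * W + (a + b) * (U + V)
    eq = solve-∀
    eq′ : ∀ s W d → s * W + s * (d * W) ≡ (1 + d) * (s * W)
    eq′ = solve-∀

  -- AM–GM for the fractions aᵢ / (aᵢ + bᵢ), with denominators cleared.
  ∏-≤-weight : ∀ {d} (a b : Fin d → ℕ) → let W = ∏ (λ i → a i + b i) in
               d ^ d * (W ^ d * ∏ a) ≤ W * weight a b ^ d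
  ∏-≤-weight {zero}  a b = ≤-refl
  ∏-≤-weight {suc d} a b = *-cancelˡ-≤ (d ^ d) {{n^n≢0 d}} (begin
    d ^ d * (suc d ^ suc d * ((s * W) ^ suc d * (a₀ * A)))
      ≡⟨ cong (λ z → d ^ d * (suc d ^ suc d * (z * (a₀ * A)))) (^-distribʳ-* (suc d) s W) ⟩
    d ^ d * (suc d ^ suc d * (s ^ suc d * W ^ suc d * (a₀ * A)))
      ≡⟨ eq₁ (d ^ d) (suc d ^ suc d) s (s ^ d) W (W ^ d) a₀ A ⟩
    suc d ^ suc d * (s ^ suc d * W * a₀) * (d ^ d * (W ^ d * A))
      ≤⟨ *-monoʳ-≤ (suc d ^ suc d * (s ^ suc d * W * a₀)) (∏-≤-weight (a ∘ suc) (b ∘ suc)) ⟩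
    suc d ^ suc d * (s ^ suc d * W * a₀) * (W * U ^ d)
      ≡⟨ eq₂ (suc d ^ suc d) s (s ^ d) W a₀ (U ^ d) ⟩
    s * W * (suc d ^ suc d * (a₀ * W * (s ^ d * U ^ d)))
      ≡⟨ cong (λ z → s * W * (suc d ^ suc d * (a₀ * W * z))) (^-distribʳ-* d s U) ⟨
    s * W * (suc d ^ suc d * (a₀ * W * (s * U) ^ d))
      ≤⟨ *-monoʳ-≤ (s * W) (am-gm d (a₀ * W) (s * U)) ⟩
    s * W * (d ^ d * (a₀ * W + s * U) ^ suc d)
      ≡⟨ eq₃ (s * W) (d ^ d) ((a₀ * W + s * U) ^ suc d) ⟩
    d ^ d * (s * W * (a₀ * W + s * U) ^ suc d) ∎)
    where
    open ≤-Reasoning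
    a₀ = a zero
    s  = a zero + b zero
    W  = ∏ (λ i → a (suc i) + b (suc i))
    A  = ∏ (a ∘ suc)
    U  = weight (a ∘ suc) (b ∘ suc)
    eq₁ : ∀ p q s sd W Wd a A → p * (q * (s * sd * (W * Wd) * (a * A))) ≡ q * (s * sd * W * a) * (p * (Wd * A))
    eq₁ = solve-∀
    eq₂ : ∀ q s sd W a Ud → q * (s * sd * W * a) * (W * Ud) ≡ s * W * (q * (a * W * (sd * Ud)))
    eq₂ = solve-∀
    eq₃ : ∀ x y z → x * (y * z) ≡ y * (x * z)
    eq₃ = solve-∀

  sum-mono : ∀ {n} {f g : Fin n → ℕ} → (∀ i → f i ≤ g i) → sum f ≤ sum g
  sum-mono {zero}  f≤g = z≤n
  sum-mono {suc n} f≤g = +-mono-≤ (f≤g zero) (sum-mono (f≤g ∘ suc))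

  ∏-mono : ∀ {n} {f g : Fin n → ℕ} → (∀ i → f i ≤ g i) → ∏ f ≤ ∏ g
  ∏-mono {zero}  f≤g = ≤-refl
  ∏-mono {suc n} f≤g = *-mono-≤ (f≤g zero) (∏-mono (f≤g ∘ suc))

  -- If U/V ≤ x/y, then the estimate x ≤ U (gW)^(1/d) / (dW) carries over to x + y.
  holder-step : ∀ {d} g (a b : Fin d → ℕ) x y →
                let U = weight a b; V = weight b a; W = ∏ (λ i → a i + b i) in
                x ^ d ≤ g * ∏ a → y ^ d ≤ g * ∏ b → y * U ≤ x * V → (x + y) ^ d ≤ g * W
  holder-step {zero} g a b x y xᵈ≤ _ _ = xᵈ≤
  holder-step {d@(suc _)} g a b x y xᵈ≤ yᵈ≤ yU≤xV with weight a b in U≡ | ∏ (λ i → a i + b i) in W≡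
  ... | U@(suc _) | W@(suc _) = *-cancelˡ-≤ (U ^ d * (d ^ d * W ^ d)) {{nz}} (begin
      U ^ d * (d ^ d * W ^ d) * (x + y) ^ d
        ≡⟨ eq₁ (U ^ d) (d ^ d) (W ^ d) ((x + y) ^ d) ⟩
      d ^ d * W ^ d * ((x + y) ^ d * U ^ d)
        ≡⟨ cong (d ^ d * W ^ d *_) (^-distribʳ-* d (x + y) U) ⟨
      d ^ d * W ^ d * ((x + y) * U) ^ d
        ≤⟨ *-monoʳ-≤ (d ^ d * W ^ d) (^-monoˡ-≤ d slope) ⟩
      d ^ d * W ^ d * (x * (d * W)) ^ d
        ≡⟨ cong (d ^ d * W ^ d *_) (^-distribʳ-* d x (d * W)) ⟩
      d ^ d * W ^ d * (x ^ d * (d * W) ^ d)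
        ≤⟨ *-monoʳ-≤ (d ^ d * W ^ d) (*-monoˡ-≤ ((d * W) ^ d) xᵈ≤) ⟩
      d ^ d * W ^ d * (g * ∏ a * (d * W) ^ d)
        ≡⟨ eq₂ (d ^ d) (W ^ d) g (∏ a) ((d * W) ^ d) ⟩
      g * (d * W) ^ d * (d ^ d * (W ^ d * ∏ a))
        ≤⟨ *-monoʳ-≤ (g * (d * W) ^ d) (subst₂ (λ W U → d ^ d * (W ^ d * ∏ a) ≤ W * U ^ d) W≡ U≡ (∏-≤-weight a b)) ⟩
      g * (d * W) ^ d * (W * U ^ d)
        ≡⟨ cong (λ z → g * z * (W * U ^ d)) (^-distribʳ-* d d W) ⟩
      g * (d ^ d * W ^ d) * (W * U ^ d)
        ≡⟨ eq₃ g (d ^ d * W ^ d) W (U ^ d) ⟩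
      U ^ d * (d ^ d * W ^ d) * (g * W) ∎)
    where
    open ≤-Reasoning
    nz : NonZero (U ^ d * (d ^ d * W ^ d))
    nz = m*n≢0 (U ^ d) (d ^ d * W ^ d) {{m^n≢0 U d}}
           {{m*n≢0 (d ^ d) (W ^ d) {{m^n≢0 d d}} {{m^n≢0 W d}}}}
    -- The hypothesis says that `x` is at least the fraction U / (U + V) of `x + y`, and U + V = dW.
    slope : (x + y) * U ≤ x * (d * W)
    slope = begin
      (x + y) * U              ≡⟨ *-distribʳ-+ U x y ⟩
      x * U + y * U            ≤⟨ +-monoʳ-≤ (x * U) yU≤xV ⟩
      x * U + x * weight b a   ≡⟨ *-distribˡ-+ x U _ ⟨
      x * (U + weight b a)     ≡⟨ cong (x *_) (subst₂ (λ U W → U + weight b a ≡ d * W) U≡ W≡ (weight-+ a b)) ⟩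
      x * (d * W)              ∎
    eq₁ : ∀ u p w z → u * (p * w) * z ≡ p * w * (z * u)
    eq₁ = solve-∀
    eq₂ : ∀ p w g a q → p * w * (g * a * q) ≡ g * q * (p * (w * a))
    eq₂ = solve-∀
    eq₃ : ∀ g p w u → g * p * (w * u) ≡ u * p * (g * w)
    eq₃ = solve-∀
  -- With zero weight, AM-GM makes `∏ a` vanish and hence `x`; the bound for `y` alone then
  -- suffices.
  ... | zero | W@(suc _) = ≤-trans (≤-reflexive (cong (λ z → (z + y) ^ d) x≡0))
                            (≤-trans yᵈ≤ (*-monoʳ-≤ g (≤-trans (∏-mono (λ i → m≤n+m (b i) (a i))) (≤-reflexive W≡))))
    where
    ∏a≤0 : ∏ a ≤ 0
    ∏a≤0 = *-cancelˡ-≤ (d ^ d * W ^ d) {{m*n≢0 (d ^ d) (W ^ d) {{m^n≢0 d d}} {{m^n≢0 W d}}}} (begin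
      d ^ d * W ^ d * ∏ a    ≡⟨ *-assoc (d ^ d) _ _ ⟩
      d ^ d * (W ^ d * ∏ a)  ≤⟨ subst₂ (λ W U → d ^ d * (W ^ d * ∏ a) ≤ W * U ^ d) W≡ U≡ (∏-≤-weight a b) ⟩
      W * 0                  ≡⟨ trans (*-zeroʳ W) (sym (*-zeroʳ (d ^ d * W ^ d))) ⟩
      d ^ d * W ^ d * 0      ∎)
      where open ≤-Reasoning
    x≡0 : x ≡ 0
    x≡0 = m^n≡0⇒m≡0 x d (n≤0⇒n≡0 (≤-trans xᵈ≤ (≤-reflexive (trans (cong (g *_) (n≤0⇒n≡0 ∏a≤0)) (*-zeroʳ g)))))
  -- Both products are at most `W`, so `x` and `y` vanish.
  ... | U | zero = ≤-reflexive (trans (cong (_^ d) (cong₂ _+_ (vanish {x} {a} xᵈ≤ (λ i → m≤m+n (a i) (b i)))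
                                                            (vanish {y} {b} yᵈ≤ (λ i → m≤n+m (b i) (a i)))))
                                  (sym (*-zeroʳ g)))
    where
    vanish : ∀ {z c} → z ^ d ≤ g * ∏ c → (∀ i → c i ≤ a i + b i) → z ≡ 0
    vanish {z} zᵈ≤ c≤ = m^n≡0⇒m≡0 z d (n≤0⇒n≡0
      (≤-trans zᵈ≤ (≤-trans (*-monoʳ-≤ g (≤-trans (∏-mono c≤) (≤-reflexive W≡))) (≤-reflexive (*-zeroʳ g)))))

  -- With real roots one would add x ≤ U (gW)^(1/d) / (dW) and y ≤ V (gW)^(1/d) / (dW), where U + V
  -- = dW. In natural numbers only one of the two bounds is used: that of the term whose share of x
  -- + y is at least its share of U + V.
  holder₂ : ∀ {d} g (a b : Fin d → ℕ) x y → x ^ d ≤ g * ∏ a → y ^ d ≤ g * ∏ b →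
            (x + y) ^ d ≤ g * ∏ (λ i → a i + b i)
  holder₂ {d} g a b x y xᵈ≤ yᵈ≤ with ≤-total (y * weight a b) (x * weight b a)
  ... | inj₁ h = holder-step g a b x y xᵈ≤ yᵈ≤ h
  ... | inj₂ h = subst₂ (λ s W → s ^ d ≤ g * W) (+-comm y x) (∏-cong (λ i → +-comm (b i) (a i)))
                   (holder-step g b a y x yᵈ≤ xᵈ≤ h)

  -- The factor `g` will be the count of one projection, common to all slices. The exponent is a
  -- successor because an empty sum to the power 0 is 1, which `g = 0` does not bound.
  holder : ∀ {d n} g (x : Fin n → ℕ) (a : Fin (suc d) → Fin n → ℕ) →
           (∀ t → x t ^ suc d ≤ g * ∏ (λ i → a i t)) →
           sum x ^ suc d ≤ g * ∏ (λ i → sum (a i))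
  holder {n = zero}  g x a h = z≤n
  holder {n = suc n} g x a h =
    holder₂ g (λ i → a i zero) (λ i → sum (a i ∘ suc)) (x zero) (sum (x ∘ suc))
      (h zero) (holder g (x ∘ suc) (λ i → a i ∘ suc) (h ∘ suc))

  -- Loomis-Whitney in the plane, pointwise: a natural number below both projections is below their
  -- product, since a factor 0 forces it to be 0.
  ≤⇒≤* : ∀ {x y z} → x ≤ y → x ≤ z → x ≤ y * z
  ≤⇒≤* {y = y} {zero}  x≤y x≤0 = ≤-trans x≤0 z≤n
  ≤⇒≤* {y = y} {suc z} x≤y _   = ≤-trans x≤y (m≤m*n y (suc z))

  -- Tuples as lists, sums over them, and Loomis-Whitney

  module _ {A : Set} where

    drop-take-++ : ∀ (u w : List A) → drop (length u) (u ++ w) ++ take (length u) (u ++ w) ≡ w ++ u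
    drop-take-++ u w = cong₂ _++_ (drop-++ u) (take-++ u)
      where
      drop-++ : ∀ u → drop (length u) (u ++ w) ≡ w
      drop-++ []      = refl
      drop-++ (_ ∷ u) = drop-++ u
      take-++ : ∀ u → take (length u) (u ++ w) ≡ u
      take-++ []      = refl
      take-++ (x ∷ u) = cong (x ∷_) (take-++ u)

    drop-suc-take-++ : ∀ u v (w : List A) →
      drop (suc (length u)) (u ++ v ∷ w) ++ take (length u) (u ++ v ∷ w) ≡ w ++ u
    drop-suc-take-++ u v w = cong₂ _++_ (drop-u u) (take-u u)
      where
      drop-u : ∀ u → drop (suc (length u)) (u ++ v ∷ w) ≡ w
      drop-u []      = refl
      drop-u (_ ∷ u) = drop-u u
      take-u : ∀ u → take (length u) (u ++ v ∷ w) ≡ u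
      take-u []      = refl
      take-u (x ∷ u) = cong (x ∷_) (take-u u)

  module _ {n : ℕ} where

    -- Tuples are lists and not vectors, so that deleting and rotating coordinates need no casts
    -- between lengths.
    sumL : ℕ → (List (Fin n) → ℕ) → ℕ
    sumL zero    F = F []
    sumL (suc k) F = sum (λ v → sumL k (λ xs → F (v ∷ xs)))

    sumL-mono : ∀ k {F G} → (∀ xs → length xs ≡ k → F xs ≤ G xs) → sumL k F ≤ sumL k G
    sumL-mono zero    F≤G = F≤G [] refl
    sumL-mono (suc k) F≤G = sum-mono (λ v → sumL-mono k (λ xs e → F≤G (v ∷ xs) (cong suc e)))

    sumL-cong : ∀ k {F G} → (∀ xs → length xs ≡ k → F xs ≡ G xs) → sumL k F ≡ sumL k G
    sumL-cong k F≡G = ≤-antisym (sumL-mono k (λ xs e → ≤-reflexive (F≡G xs e)))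
                                (sumL-mono k (λ xs e → ≤-reflexive (sym (F≡G xs e))))

    sumL-*ʳ : ∀ k F z → sumL k (λ xs → F xs * z) ≡ sumL k F * z
    sumL-*ʳ zero    F z = refl
    sumL-*ʳ (suc k) F z =
      trans (sum-cong-≗ (λ v → sumL-*ʳ k (F ∘ (v ∷_)) z)) (sym (*-distribʳ-sum z (λ v → sumL k (F ∘ (v ∷_)))))

    sumL-distrib-+ : ∀ k F G → sumL k (λ xs → F xs + G xs) ≡ sumL k F + sumL k G
    sumL-distrib-+ zero    F G = refl
    sumL-distrib-+ (suc k) F G =
      trans (sum-cong-≗ (λ v → sumL-distrib-+ k (F ∘ (v ∷_)) (G ∘ (v ∷_))))
            (∑-distrib-+ (λ v → sumL k (F ∘ (v ∷_))) (λ v → sumL k (G ∘ (v ∷_))))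

    sum-sumL-comm : ∀ {m} k (H : Fin m → List (Fin n) → ℕ) →
                    sum (λ v → sumL k (H v)) ≡ sumL k (λ xs → sum (λ v → H v xs))
    sum-sumL-comm zero    H = refl
    sum-sumL-comm (suc k) H =
      trans (∑-comm (λ v u → sumL k (H v ∘ (u ∷_)))) (sum-cong-≗ (λ u → sum-sumL-comm k (λ v → H v ∘ (u ∷_))))

    sumL-comm : ∀ a b (H : List (Fin n) → List (Fin n) → ℕ) →
                sumL a (λ u → sumL b (H u)) ≡ sumL b (λ w → sumL a (λ u → H u w))
    sumL-comm zero    b H = refl
    sumL-comm (suc a) b H =
      trans (sum-cong-≗ (λ v → sumL-comm a b (H ∘ (v ∷_)))) (sum-sumL-comm b (λ v w → sumL a (λ u → H (v ∷ u) w)))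

    sumL-++ : ∀ a b F → sumL (a + b) F ≡ sumL a (λ u → sumL b (λ w → F (u ++ w)))
    sumL-++ zero    b F = refl
    sumL-++ (suc a) b F = sum-cong-≗ (λ v → sumL-++ a b (F ∘ (v ∷_)))

    -- Rotation permutes the tuples. It is needed because deleting coordinate i of a cycle leaves a
    -- path that starts in position i of the remaining tuple.
    sumL-rotate : ∀ a b F → sumL (a + b) (λ xs → F (drop a xs ++ take a xs)) ≡ sumL (a + b) F
    sumL-rotate a b F = begin
      sumL (a + b) (λ xs → F (drop a xs ++ take a xs))
        ≡⟨ sumL-++ a b _ ⟩
      sumL a (λ u → sumL b (λ w → F (drop a (u ++ w) ++ take a (u ++ w))))
        ≡⟨ sumL-cong a (λ { u refl → sumL-cong b (λ w _ → cong F (drop-take-++ u w)) }) ⟩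
      sumL a (λ u → sumL b (λ w → F (w ++ u)))
        ≡⟨ sumL-comm a b _ ⟩
      sumL b (λ w → sumL a (λ u → F (w ++ u)))
        ≡⟨ sumL-++ b a F ⟨
      sumL (b + a) F
        ≡⟨ cong (λ k → sumL k F) (+-comm b a) ⟩
      sumL (a + b) F ∎
      where open ≡-Reasoning

    -- Slicing along the first coordinate: each slice is bounded by the projection
    -- along that coordinate and, inductively, by its own projections.
    loomis-whitney : ∀ j F (G : Fin (2 + j) → List (Fin n) → ℕ) →
      (∀ i u v w → length u ≡ toℕ i → F (u ++ v ∷ w) ≤ G i (u ++ w)) →
      sumL (2 + j) F ^ suc j ≤ ∏ (λ i → sumL (suc j) (G i))
    loomis-whitney j F G F≤G =
      holder (sumL (suc j) (G zero)) (λ t → sumL (suc j) (F ∘ (t ∷_))) (λ i t → sumL j (G (suc i) ∘ (t ∷_)))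
        (slice j F G F≤G)
      where
      slice : ∀ j F (G : Fin (2 + j) → List (Fin n) → ℕ) →
        (∀ i u v w → length u ≡ toℕ i → F (u ++ v ∷ w) ≤ G i (u ++ w)) →
        ∀ t → sumL (suc j) (F ∘ (t ∷_)) ^ suc j
              ≤ sumL (suc j) (G zero) * ∏ (λ i → sumL j (G (suc i) ∘ (t ∷_)))
      slice zero F G F≤G t = begin
        sumL 1 (F ∘ (t ∷_)) * 1
          ≡⟨ *-identityʳ _ ⟩
        sumL 1 (F ∘ (t ∷_))
          ≤⟨ sumL-mono 1 {F ∘ (t ∷_)} {λ xs → G zero xs * G (suc zero) (t ∷ [])}
               (λ { (x ∷ []) _ → ≤⇒≤* (F≤G zero [] t (x ∷ []) refl) (F≤G (suc zero) (t ∷ []) x [] refl) }) ⟩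
        sumL 1 (λ xs → G zero xs * G (suc zero) (t ∷ []))
          ≡⟨ sumL-*ʳ 1 (G zero) _ ⟩
        sumL 1 (G zero) * G (suc zero) (t ∷ [])
          ≡⟨ cong (sumL 1 (G zero) *_) (*-identityʳ _) ⟨
        sumL 1 (G zero) * (G (suc zero) (t ∷ []) * 1) ∎
        where open ≤-Reasoning
      slice (suc j) F G F≤G t =
        *-mono-≤ (sumL-mono (2 + j) (λ xs _ → F≤G zero [] t xs refl))
                 (loomis-whitney j (F ∘ (t ∷_)) (λ i → G (suc i) ∘ (t ∷_))
                   (λ i u v w e → F≤G (suc i) (t ∷ u) v w (cong suc e)))

  -- Induced paths and cycles as lists of vertices

  𝟙 : Bool → ℕ
  𝟙 true  = 1
  𝟙 false = 0

  𝟙≤1 : ∀ b → 𝟙 b ≤ 1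
  𝟙≤1 true  = ≤-refl
  𝟙≤1 false = z≤n

  sum₂ : ∀ {m n} → (Fin m → Fin n → ℕ) → ℕ
  sum₂ f = sum (λ u → sum (f u))

  sum₂-mono : ∀ {m n} {f g : Fin m → Fin n → ℕ} → (∀ u v → f u v ≤ g u v) → sum₂ f ≤ sum₂ g
  sum₂-mono f≤g = sum-mono (λ u → sum-mono (f≤g u))

  sum₂-cong : ∀ {m n} {f g : Fin m → Fin n → ℕ} → (∀ u v → f u v ≡ g u v) → sum₂ f ≡ sum₂ g
  sum₂-cong f≡g = sum-cong-≗ (λ u → sum-cong-≗ (f≡g u))

  sum₂-distrib-+ : ∀ {m n} (f g : Fin m → Fin n → ℕ) → sum₂ (λ u v → f u v + g u v) ≡ sum₂ f + sum₂ g
  sum₂-distrib-+ f g = trans (sum-cong-≗ (λ u → ∑-distrib-+ (f u) (g u))) (∑-distrib-+ (sum ∘ f) (sum ∘ g))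

  sum₂-*ˡ : ∀ {m n} z (f : Fin m → Fin n → ℕ) → z * sum₂ f ≡ sum₂ (λ u v → z * f u v)
  sum₂-*ˡ z f = trans (*-distribˡ-sum z (sum ∘ f)) (sum-cong-≗ (λ u → *-distribˡ-sum z (f u)))

  _<ᵇ′_ : ∀ {n} → Fin n → Fin n → Bool
  u <ᵇ′ v = does (u Fin.<? v)

  -- Turns a sum over ordered pairs into one over unordered pairs, each carrying both of its
  -- orientations.
  sum₂-symmetrize : ∀ {n} (f : Fin n → Fin n → ℕ) → (∀ u → f u u ≡ 0) →
                    sum₂ f ≡ sum₂ (λ u v → 𝟙 (u <ᵇ′ v) * (f u v + f v u))
  sum₂-symmetrize f f≡0 = begin
    sum₂ f
      ≡⟨ sum₂-cong split ⟩
    sum₂ (λ u v → 𝟙 (u <ᵇ′ v) * f u v + 𝟙 (v <ᵇ′ u) * f u v)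
      ≡⟨ sum₂-distrib-+ (λ u v → 𝟙 (u <ᵇ′ v) * f u v) (λ u v → 𝟙 (v <ᵇ′ u) * f u v) ⟩
    sum₂ (λ u v → 𝟙 (u <ᵇ′ v) * f u v) + sum₂ (λ u v → 𝟙 (v <ᵇ′ u) * f u v)
      ≡⟨ cong (sum₂ (λ u v → 𝟙 (u <ᵇ′ v) * f u v) +_) (∑-comm (λ u v → 𝟙 (v <ᵇ′ u) * f u v)) ⟩
    sum₂ (λ u v → 𝟙 (u <ᵇ′ v) * f u v) + sum₂ (λ u v → 𝟙 (u <ᵇ′ v) * f v u)
      ≡⟨ sum₂-distrib-+ (λ u v → 𝟙 (u <ᵇ′ v) * f u v) (λ u v → 𝟙 (u <ᵇ′ v) * f v u) ⟨
    sum₂ (λ u v → 𝟙 (u <ᵇ′ v) * f u v + 𝟙 (u <ᵇ′ v) * f v u)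
      ≡⟨ sum₂-cong (λ u v → *-distribˡ-+ (𝟙 (u <ᵇ′ v)) (f u v) (f v u)) ⟨
    sum₂ (λ u v → 𝟙 (u <ᵇ′ v) * (f u v + f v u)) ∎
    where
    open ≡-Reasoning
    split : ∀ u v → f u v ≡ 𝟙 (u <ᵇ′ v) * f u v + 𝟙 (v <ᵇ′ u) * f u v
    split u v with Fin.<-cmp u v
    ... | tri< u<v _ v≮u rewrite dec-true (u Fin.<? v) u<v | dec-false (v Fin.<? u) v≮u =
      sym (trans (+-identityʳ _) (+-identityʳ _))
    ... | tri> u≮v _ v<u rewrite dec-false (u Fin.<? v) u≮v | dec-true (v Fin.<? u) v<u =
      sym (+-identityʳ _)
    ... | tri≈ u≮u refl _ rewrite dec-false (u Fin.<? u) u≮u = f≡0 u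

  module Paths {n : ℕ} (adj : Fin n → Fin n → Bool)
               (adj-sym : ∀ u v → adj u v ≡ adj v u) (adj-irrefl : ∀ u → adj u u ≡ false) where

    V : Set
    V = Fin n

    arcs : (V → V → Bool) → ℕ
    arcs X = sum₂ (λ u v → 𝟙 (X u v))

    edges : ℕ
    edges = sum₂ (λ u v → 𝟙 (u <ᵇ′ v) * 𝟙 (adj u v))

    arcs≡2edges : arcs adj ≡ 2 * edges
    arcs≡2edges = trans (sum₂-symmetrize (λ u v → 𝟙 (adj u v)) (λ u → cong 𝟙 (adj-irrefl u)))
      (trans (sum₂-cong (λ u v → trans (cong (λ b → 𝟙 (u <ᵇ′ v) * (𝟙 (adj u v) + 𝟙 b)) (adj-sym v u))
                                       (eq (𝟙 (u <ᵇ′ v)) (𝟙 (adj u v)))))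
             (sym (sum₂-*ˡ 2 (λ u v → 𝟙 (u <ᵇ′ v) * 𝟙 (adj u v)))))
      where
      eq : ∀ a b → a * (b + b) ≡ 2 * (a * b)
      eq = solve-∀

    module _ (x y : V) (X : V → V → Bool) where

      -- The edges that may follow xy on an induced path, directed away from xy. The condition is
      -- symmetric in x and y, since xy may be traversed either way.
      isNext : V → V → Bool
      isNext u v = X u v ∧ (adj x u ∨ adj y u) ∧ not (adj x v) ∧ not (adj y v)

      remote : V → V → Bool
      remote u v = X u v ∧ not (adj x u) ∧ not (adj y u) ∧ not (adj x v) ∧ not (adj y v)

      module _ (X-sym : ∀ u v → X u v ≡ X v u) where

        remote-sym : ∀ u v → remote u v ≡ remote v u
        remote-sym u v rewrite X-sym u v with X v u | adj x u | adj y u | adj x v | adj y v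
        ... | false | _     | _     | _     | _     = refl
        ... | true  | false | false | false | false = refl
        ... | true  | false | false | false | true  = refl
        ... | true  | false | false | true  | _     = refl
        ... | true  | false | true  | false | false = refl
        ... | true  | false | true  | false | true  = refl
        ... | true  | false | true  | true  | _     = refl
        ... | true  | true  | _     | false | false = refl
        ... | true  | true  | _     | false | true  = refl
        ... | true  | true  | _     | true  | _     = refl

        -- Call a vertex attached if it is adjacent to x or y. In `isNext u v` only u is attached,
        -- in `isNext v u` only v, in `remote u v` neither, so at most one of the three holds. The
        -- first two have the same total, whence the factor 2.
        arcs-isNext : 2 * arcs isNext + arcs remote ≤ arcs X
        arcs-isNext = begin
          2 * arcs isNext + arcs remote
            ≡⟨ cong (λ z → arcs isNext + z + arcs remote)
                 (trans (+-identityʳ _) (∑-comm (λ u v → 𝟙 (isNext u v)))) ⟩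
          arcs isNext + arcs (flip isNext) + arcs remote
            ≡⟨ cong (_+ arcs remote) (sum₂-distrib-+ (λ u v → 𝟙 (isNext u v)) (λ u v → 𝟙 (isNext v u))) ⟨
          sum₂ (λ u v → 𝟙 (isNext u v) + 𝟙 (isNext v u)) + arcs remote
            ≡⟨ sum₂-distrib-+ (λ u v → 𝟙 (isNext u v) + 𝟙 (isNext v u)) (λ u v → 𝟙 (remote u v)) ⟨
          sum₂ (λ u v → 𝟙 (isNext u v) + 𝟙 (isNext v u) + 𝟙 (remote u v))
            ≤⟨ sum₂-mono disjoint ⟩
          arcs X ∎
          where
          open ≤-Reasoning
          disjoint : ∀ u v → 𝟙 (isNext u v) + 𝟙 (isNext v u) + 𝟙 (remote u v) ≤ 𝟙 (X u v)
          disjoint u v rewrite X-sym v u with X u v | adj x u | adj y u | adj x v | adj y v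
          ... | false | _     | _     | _     | _     = z≤n
          ... | true  | false | false | false | false = ≤-refl
          ... | true  | false | false | false | true  = ≤-refl
          ... | true  | false | false | true  | _     = ≤-refl
          ... | true  | false | true  | false | false = ≤-refl
          ... | true  | false | true  | false | true  = z≤n
          ... | true  | false | true  | true  | _     = z≤n
          ... | true  | true  | _     | false | false = ≤-refl
          ... | true  | true  | _     | false | true  = z≤n
          ... | true  | true  | _     | true  | _     = z≤n

    -- chain x y X [x₃,x₄,x₅,x₆,…] indicates that each edge x₂ᵢ₊₁x₂ᵢ₊₂ continues the
    -- path from the preceding edge, which at the start is xy in either direction,
    -- using only edges in X.
    chain : V → V → (V → V → Bool) → List V → ℕ
    chain x y X []           = 1
    chain x y X (u ∷ [])     = 0
    chain x y X (u ∷ v ∷ zs) = chain u v (remote x y X) zs * 𝟙 (isNext x y X u v)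

    -- If α edges may come next, at most β = M - α are left for the remaining j. By induction there
    -- are at most α (β/j)^j chains, and weighted AM-GM bounds this by (M/(1+j))^(1+j). `M` is only
    -- an upper bound for the number of edges in `X`, so that β can be a plain difference.
    chain-bound : ∀ j x y X M → (∀ u v → X u v ≡ X v u) → arcs X ≤ 2 * M →
                  j ^ j * sumL (j * 2) (chain x y X) ≤ M ^ j
    chain-bound zero    x y X M X-sym arcs≤ = ≤-refl
    chain-bound (suc j) x y X M X-sym arcs≤ with m≤n⇒∃[o]m+o≡n α≤M
      where
      α≤M : arcs (isNext x y X) ≤ M
      α≤M = *-cancelˡ-≤ 2 (≤-trans (m≤m+n _ _) (≤-trans (arcs-isNext x y X X-sym) arcs≤))
    ... | β , refl = *-cancelˡ-≤ (j ^ j) {{n^n≢0 j}} (begin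
      j ^ j * (suc j ^ suc j * sumL (suc j * 2) (chain x y X))
        ≡⟨ eq (j ^ j) (suc j ^ suc j) _ ⟩
      suc j ^ suc j * (j ^ j * sumL (suc j * 2) (chain x y X))
        ≤⟨ *-monoʳ-≤ (suc j ^ suc j) continuations ⟩
      suc j ^ suc j * (α * β ^ j)
        ≤⟨ am-gm j α β ⟩
      j ^ j * (α + β) ^ suc j ∎)
      where
      open ≤-Reasoning
      eq : ∀ p q r → p * (q * r) ≡ q * (p * r)
      eq = solve-∀
      N = isNext x y X
      R = remote x y X
      α = arcs N
      arcsR≤ : arcs R ≤ 2 * β
      arcsR≤ = +-cancelˡ-≤ (2 * α) _ _
        (≤-trans (arcs-isNext x y X X-sym) (≤-trans arcs≤ (≤-reflexive (*-distribˡ-+ 2 α β))))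
      continuations : j ^ j * sumL (suc j * 2) (chain x y X) ≤ α * β ^ j
      continuations = begin
        j ^ j * sum₂ (λ u v → sumL (j * 2) (λ zs → chain u v R zs * 𝟙 (N u v)))
          ≡⟨ sum₂-*ˡ (j ^ j) (λ u v → sumL (j * 2) (λ zs → chain u v R zs * 𝟙 (N u v))) ⟩
        sum₂ (λ u v → j ^ j * sumL (j * 2) (λ zs → chain u v R zs * 𝟙 (N u v)))
          ≡⟨ sum₂-cong (λ u v → trans (cong (j ^ j *_) (sumL-*ʳ (j * 2) (chain u v R) (𝟙 (N u v)))) (sym (*-assoc (j ^ j) _ _))) ⟩
        sum₂ (λ u v → j ^ j * sumL (j * 2) (chain u v R) * 𝟙 (N u v))
          ≤⟨ sum₂-mono (λ u v → *-monoˡ-≤ (𝟙 (N u v)) (chain-bound j u v R β (remote-sym x y X X-sym) arcsR≤)) ⟩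
        sum₂ (λ u v → β ^ j * 𝟙 (N u v))
          ≡⟨ sum₂-*ˡ (β ^ j) (λ u v → 𝟙 (N u v)) ⟨
        β ^ j * α
          ≡⟨ *-comm (β ^ j) α ⟩
        α * β ^ j ∎

    nonadj : V → List V → Bool
    nonadj x = all (λ z → not (adj x z))

    -- Distinctness of the vertices is not imposed: the tuples are only ever bounded from above, so
    -- counting a few more does no harm.
    path : List V → Bool
    path []           = true
    path (x ∷ [])     = true
    path (x ∷ y ∷ zs) = adj x y ∧ nonadj x zs ∧ path (y ∷ zs)

    ∧-elim : ∀ {a b} → T (a ∧ b) → T a × T b
    ∧-elim = Equivalence.to T-∧

    ∧-intro : ∀ {a b} → T a → T b → T (a ∧ b)
    ∧-intro p q = Equivalence.from T-∧ (p , q)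

    nonadj-∈ : ∀ {x z} zs → T (nonadj x zs) → z ∈ zs → T (not (adj x z))
    nonadj-∈ (z ∷ zs) p (here refl) = proj₁ (∧-elim p)
    nonadj-∈ (z ∷ zs) p (there z∈)  = nonadj-∈ zs (proj₂ (∧-elim p)) z∈

    𝟙-T : ∀ {b} → T b → 𝟙 b ≡ 1
    𝟙-T {true} _ = refl

    -- The vertices after u are nonadjacent to x and y, so uv passes `isNext` and all later edges
    -- pass `remote`. The last hypothesis keeps the rest of the path inside `X` while `X` shrinks
    -- along the recursion.
    path⇒chain : ∀ j x y X u v zs → length zs ≡ j * 2 → T (path (u ∷ v ∷ zs)) → T (adj x u ∨ adj y u) →
      (∀ {a} → a ∈ v ∷ zs → T (not (adj x a)) × T (not (adj y a))) →
      (∀ {a b} → a ∈ u ∷ v ∷ zs → b ∈ u ∷ v ∷ zs → T (adj a b) → T (X a b)) →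
      chain x y X (u ∷ v ∷ zs) ≡ 1
    path⇒chain j x y X u v zs len p joined nonadj-xy inX =
      trans (cong (chain u v (remote x y X) zs *_) (𝟙-T next)) (trans (*-identityʳ _) (rest j zs len p nonadj-xy inX))
      where
      next : T (isNext x y X u v)
      next = ∧-intro (inX (here refl) (there (here refl)) (proj₁ (∧-elim p)))
               (∧-intro joined (∧-intro (proj₁ (nonadj-xy (here refl))) (proj₂ (nonadj-xy (here refl)))))
      rest : ∀ j zs → length zs ≡ j * 2 → T (path (u ∷ v ∷ zs)) →
        (∀ {a} → a ∈ v ∷ zs → T (not (adj x a)) × T (not (adj y a))) →
        (∀ {a b} → a ∈ u ∷ v ∷ zs → b ∈ u ∷ v ∷ zs → T (adj a b) → T (X a b)) →
        chain u v (remote x y X) zs ≡ 1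
      rest j       []           len p h inX = refl
      rest zero    (_ ∷ [])     () p h inX
      rest (suc j) (_ ∷ [])     () p h inX
      rest (suc j) (u′ ∷ v′ ∷ zs) len p h inX with ∧-elim {adj u v} p
      ... | _ , p₁ with ∧-elim {nonadj u (u′ ∷ v′ ∷ zs)} p₁
      ... | nu , p₂ with ∧-elim {adj v u′} p₂
      ... | vu′ , p₃ with ∧-elim {nonadj v (v′ ∷ zs)} p₃
      ... | nv , p₄ = path⇒chain j u v (remote x y X) u′ v′ zs (suc-injective (suc-injective len)) p₄
        (Equivalence.from T-∨ (inj₂ vu′))
        (λ a∈ → nonadj-∈ (u′ ∷ v′ ∷ zs) nu (there a∈) , nonadj-∈ (v′ ∷ zs) nv a∈)
        (λ a∈ b∈ ab → ∧-intro (inX (there (there a∈)) (there (there b∈)) ab)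
           (∧-intro (proj₁ (h (there a∈))) (∧-intro (proj₂ (h (there a∈)))
           (∧-intro (proj₁ (h (there b∈))) (proj₂ (h (there b∈)))))))

    T-not : ∀ {b} → T b → T (not b) → ∀ {ℓ} {A : Set ℓ} → A
    T-not {true} _ ()

    -- `isNext` and `remote` treat x and y alike, so one path is indicated by the chains from either
    -- orientation of its first edge.
    path⇒chain₀ : ∀ j x y u v zs → length zs ≡ j * 2 → T (path (x ∷ y ∷ u ∷ v ∷ zs)) →
      T (adj x y) × chain x y adj (u ∷ v ∷ zs) ≡ 1 × chain y x adj (u ∷ v ∷ zs) ≡ 1
    path⇒chain₀ j x y u v zs len p with ∧-elim {adj x y} p
    ... | xy , p₁ with ∧-elim {nonadj x (u ∷ v ∷ zs)} p₁
    ... | nx , p₂ with ∧-elim {adj y u} p₂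
    ... | yu , p₃ with ∧-elim {nonadj y (v ∷ zs)} p₃
    ... | ny , p₄ =
        xy
      , path⇒chain j x y adj u v zs len p₄ (Equivalence.from T-∨ (inj₂ yu))
          (λ a∈ → nonadj-∈ (u ∷ v ∷ zs) nx (there a∈) , nonadj-∈ (v ∷ zs) ny a∈) (λ _ _ ab → ab)
      , path⇒chain j y x adj u v zs len p₄ (Equivalence.from T-∨ (inj₁ yu))
          (λ a∈ → nonadj-∈ (v ∷ zs) ny a∈ , nonadj-∈ (u ∷ v ∷ zs) nx (there a∈)) (λ _ _ ab → ab)

    -- A path x y u … has x ≁ u, whereas a path y x u … has x ~ u.
    path-directions : ∀ j x y zs → length zs ≡ suc j * 2 →
      𝟙 (path (x ∷ y ∷ zs)) + 𝟙 (path (y ∷ x ∷ zs)) ≤ chain x y adj zs * 𝟙 (adj x y)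
    path-directions j x y (u ∷ v ∷ zs) len
      with path (x ∷ y ∷ u ∷ v ∷ zs) in eq₁ | path (y ∷ x ∷ u ∷ v ∷ zs) in eq₂
    ... | false | false = z≤n
    ... | true  | false with path⇒chain₀ j x y u v zs (suc-injective (suc-injective len)) (Equivalence.from T-≡ eq₁)
    ... | xy , c≡1 , _ = ≤-reflexive (sym (cong₂ _*_ c≡1 (𝟙-T xy)))
    path-directions j x y (u ∷ v ∷ zs) len
        | false | true  with path⇒chain₀ j y x u v zs (suc-injective (suc-injective len)) (Equivalence.from T-≡ eq₂)
    ... | yx , _ , c≡1 = ≤-reflexive (sym (cong₂ _*_ c≡1 (trans (cong 𝟙 (adj-sym x y)) (𝟙-T yx))))
    path-directions j x y (u ∷ v ∷ zs) len
        | true  | true  with ∧-elim {adj x y} (Equivalence.from T-≡ eq₁) | ∧-elim {adj y x} (Equivalence.from T-≡ eq₂)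
    ... | _ , p | _ , q with ∧-elim {nonadj x (u ∷ v ∷ zs)} p | ∧-elim {nonadj y (u ∷ v ∷ zs)} q
    ... | nx , _ | _ , q′ = T-not (proj₁ (∧-elim {adj x u} q′)) (nonadj-∈ (u ∷ v ∷ zs) nx (here refl))

    -- The paths have 2l vertices, where l = 2 + j.
    paths-bound : ∀ j → suc j ^ suc j * sumL ((2 + j) * 2) (λ xs → 𝟙 (path xs)) ≤ edges ^ (2 + j)
    paths-bound j = begin
      suc j ^ suc j * sum₂ P
        ≡⟨ cong (suc j ^ suc j *_) (sum₂-symmetrize P P≡0) ⟩
      suc j ^ suc j * sum₂ (λ x y → 𝟙 (x <ᵇ′ y) * (P x y + P y x))
        ≡⟨ sum₂-*ˡ (suc j ^ suc j) (λ x y → 𝟙 (x <ᵇ′ y) * (P x y + P y x)) ⟩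
      sum₂ (λ x y → suc j ^ suc j * (𝟙 (x <ᵇ′ y) * (P x y + P y x)))
        ≤⟨ sum₂-mono per-edge ⟩
      sum₂ (λ x y → edges ^ suc j * (𝟙 (x <ᵇ′ y) * 𝟙 (adj x y)))
        ≡⟨ sum₂-*ˡ (edges ^ suc j) (λ x y → 𝟙 (x <ᵇ′ y) * 𝟙 (adj x y)) ⟨
      edges ^ suc j * edges
        ≡⟨ *-comm (edges ^ suc j) edges ⟩
      edges ^ (2 + j) ∎
      where
      open ≤-Reasoning
      P : V → V → ℕ
      P x y = sumL (suc j * 2) (λ zs → 𝟙 (path (x ∷ y ∷ zs)))
      P≡0 : ∀ x → P x x ≡ 0
      -- Zero is written `0 * 0` so that `sumL-*ʳ` can evaluate the sum.
      P≡0 x = trans (sumL-cong (suc j * 2) {λ zs → 𝟙 (path (x ∷ x ∷ zs))} {λ _ → 0 * 0} (λ zs _ → loop zs))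
        (trans (sumL-*ʳ {n} (suc j * 2) (λ _ → 0) 0) (*-zeroʳ (sumL {n} (suc j * 2) (λ _ → 0))))
        where
        loop : ∀ zs → 𝟙 (path (x ∷ x ∷ zs)) ≡ 0 * 0
        loop zs rewrite adj-irrefl x = refl
      -- Given `zs`, at most one direction of the edge xy continues to a path, so the first edge
      -- contributes `edges` and not twice that.
      directions : ∀ x y → P x y + P y x ≤ sumL (suc j * 2) (chain x y adj) * 𝟙 (adj x y)
      directions x y = begin
        P x y + P y x
          ≡⟨ sumL-distrib-+ (suc j * 2) (λ zs → 𝟙 (path (x ∷ y ∷ zs))) (λ zs → 𝟙 (path (y ∷ x ∷ zs))) ⟨
        sumL (suc j * 2) (λ zs → 𝟙 (path (x ∷ y ∷ zs)) + 𝟙 (path (y ∷ x ∷ zs)))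
          ≤⟨ sumL-mono (suc j * 2) (path-directions j x y) ⟩
        sumL (suc j * 2) (λ zs → chain x y adj zs * 𝟙 (adj x y))
          ≡⟨ sumL-*ʳ (suc j * 2) (chain x y adj) _ ⟩
        sumL (suc j * 2) (chain x y adj) * 𝟙 (adj x y) ∎
      eq : ∀ a b c d → a * (b * (c * d)) ≡ a * c * (b * d)
      eq = solve-∀
      per-edge : ∀ x y → suc j ^ suc j * (𝟙 (x <ᵇ′ y) * (P x y + P y x))
                         ≤ edges ^ suc j * (𝟙 (x <ᵇ′ y) * 𝟙 (adj x y))
      per-edge x y = begin
        suc j ^ suc j * (𝟙 (x <ᵇ′ y) * (P x y + P y x))
          ≤⟨ *-monoʳ-≤ (suc j ^ suc j) (*-monoʳ-≤ (𝟙 (x <ᵇ′ y)) (directions x y)) ⟩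
        suc j ^ suc j * (𝟙 (x <ᵇ′ y) * (sumL (suc j * 2) (chain x y adj) * 𝟙 (adj x y)))
          ≡⟨ eq (suc j ^ suc j) (𝟙 (x <ᵇ′ y)) _ _ ⟩
        suc j ^ suc j * sumL (suc j * 2) (chain x y adj) * (𝟙 (x <ᵇ′ y) * 𝟙 (adj x y))
          ≤⟨ *-monoˡ-≤ (𝟙 (x <ᵇ′ y) * 𝟙 (adj x y)) (chain-bound (suc j) x y adj edges adj-sym (≤-reflexive arcs≡2edges)) ⟩
        edges ^ suc j * (𝟙 (x <ᵇ′ y) * 𝟙 (adj x y)) ∎

    -- xs is a cycle if deleting any vertex leaves a path starting at its successor.
    cycle : ℕ → List V → ℕ
    cycle k xs = ∏ {k} (λ i → 𝟙 (path (drop (suc (toℕ i)) xs ++ take (toℕ i) xs)))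

    -- All k projections in Loomis-Whitney have the same total P, each being the path indicator up
    -- to a rotation. The path bound is then raised to the power k.
    cycles-bound : ∀ j → let k = suc ((2 + j) * 2) in
      sumL k (cycle k) ^ ((2 + j) * 2) * (suc j ^ suc j) ^ k ≤ (edges ^ (2 + j)) ^ k
    cycles-bound j = begin
      N ^ d * (suc j ^ suc j) ^ suc d
        ≤⟨ *-monoˡ-≤ ((suc j ^ suc j) ^ suc d) (loomis-whitney (suc (suc j * 2)) (cycle (suc d)) G cycle≤G) ⟩
      ∏ (λ i → sumL d (G i)) * (suc j ^ suc j) ^ suc d
        ≡⟨ cong (_* (suc j ^ suc j) ^ suc d) (trans (∏-cong rotate) (∏-const (suc d))) ⟩
      P ^ suc d * (suc j ^ suc j) ^ suc d
        ≡⟨ *-comm (P ^ suc d) _ ⟩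
      (suc j ^ suc j) ^ suc d * P ^ suc d
        ≡⟨ ^-distribʳ-* (suc d) (suc j ^ suc j) P ⟨
      (suc j ^ suc j * P) ^ suc d
        ≤⟨ ^-monoˡ-≤ (suc d) (paths-bound j) ⟩
      (edges ^ (2 + j)) ^ suc d ∎
      where
      open ≤-Reasoning
      d = (2 + j) * 2
      N = sumL (suc d) (cycle (suc d))
      P = sumL d (λ xs → 𝟙 (path xs))
      G : Fin (suc d) → List V → ℕ
      G i ys = 𝟙 (path (drop (toℕ i) ys ++ take (toℕ i) ys))
      ∏-const : ∀ k → ∏ {k} (λ _ → P) ≡ P ^ k
      ∏-const zero    = refl
      ∏-const (suc k) = cong (P *_) (∏-const k)
      ∏≤1 : ∀ {k} {f : Fin k → ℕ} → (∀ i → f i ≤ 1) → ∏ f ≤ 1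
      ∏≤1 {zero}  h = ≤-refl
      ∏≤1 {suc k} h = *-mono-≤ (h zero) (∏≤1 (h ∘ suc))
      ∏≤factor : ∀ {k} {f : Fin k → ℕ} → (∀ i → f i ≤ 1) → ∀ i → ∏ f ≤ f i
      ∏≤factor {f = f} h zero    = ≤-trans (*-monoʳ-≤ (f zero) (∏≤1 (h ∘ suc))) (≤-reflexive (*-identityʳ _))
      ∏≤factor {f = f} h (suc i) = ≤-trans (*-mono-≤ (h zero) (∏≤factor (h ∘ suc) i)) (≤-reflexive (*-identityˡ _))
      cycle≤G : ∀ i u v w → length u ≡ toℕ i → cycle (suc d) (u ++ v ∷ w) ≤ G i (u ++ w)
      cycle≤G i u v w len = begin
        cycle (suc d) (u ++ v ∷ w)
          ≤⟨ ∏≤factor (λ i → 𝟙≤1 (path (drop (suc (toℕ i)) (u ++ v ∷ w) ++ take (toℕ i) (u ++ v ∷ w)))) i ⟩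
        𝟙 (path (drop (suc (toℕ i)) (u ++ v ∷ w) ++ take (toℕ i) (u ++ v ∷ w)))
          ≡⟨ cong (λ l → 𝟙 (path (drop (suc l) (u ++ v ∷ w) ++ take l (u ++ v ∷ w)))) len ⟨
        𝟙 (path (drop (suc (length u)) (u ++ v ∷ w) ++ take (length u) (u ++ v ∷ w)))
          ≡⟨ cong (λ z → 𝟙 (path z)) (trans (drop-suc-take-++ u v w) (sym (drop-take-++ u w))) ⟩
        𝟙 (path (drop (length u) (u ++ w) ++ take (length u) (u ++ w)))
          ≡⟨ cong (λ l → 𝟙 (path (drop l (u ++ w) ++ take l (u ++ w)))) len ⟩
        G i (u ++ w) ∎
      rotate : ∀ i → sumL d (G i) ≡ P
      rotate i with m≤n⇒∃[o]m+o≡n (Fin.toℕ≤pred[n] i)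
      ... | b , eq = subst (λ d → sumL d (G i) ≡ sumL d (λ xs → 𝟙 (path xs))) eq (sumL-rotate (toℕ i) b (λ xs → 𝟙 (path xs)))

  -- The 2k traversals of each copy of C k

  length-filter-tabulate : ∀ {A : Set} {P : A → Set} (P? : Unary.Decidable P) {n} (f : Fin n → A) →
    length (filter P? (tabulate f)) ≡ sum (λ i → 𝟙 (does (P? (f i))))
  length-filter-tabulate P? {zero}  f = refl
  length-filter-tabulate P? {suc n} f with does (P? (f zero))
  ... | true  = cong suc (length-filter-tabulate P? (f ∘ suc))
  ... | false = length-filter-tabulate P? (f ∘ suc)

  length-filter-product : ∀ {A B : Set} {P : A × B → Set} (P? : Unary.Decidable P) {m n} (f : Fin m → A) (g : Fin n → B) →
    length (filter P? (cartesianProduct (tabulate f) (tabulate g))) ≡ sum₂ (λ i j → 𝟙 (does (P? (f i , g j))))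
  length-filter-product P? {zero}  f g = refl
  length-filter-product P? {suc m} f g = begin
    length (filter P? (List.map (f zero ,_) (tabulate g) ++ cartesianProduct (tabulate (f ∘ suc)) (tabulate g)))
      ≡⟨ cong length (List.filter-++ P? (List.map (f zero ,_) (tabulate g)) _) ⟩
    length (filter P? (List.map (f zero ,_) (tabulate g)) ++ filter P? (cartesianProduct (tabulate (f ∘ suc)) (tabulate g)))
      ≡⟨ List.length-++ (filter P? (List.map (f zero ,_) (tabulate g))) ⟩
    length (filter P? (List.map (f zero ,_) (tabulate g))) + length (filter P? (cartesianProduct (tabulate (f ∘ suc)) (tabulate g)))
      ≡⟨ cong₂ _+_ (trans (cong (length ∘ filter P?) (List.map-tabulate g (f zero ,_)))
                          (length-filter-tabulate P? (λ j → f zero , g j)))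
                   (length-filter-product P? (f ∘ suc) g) ⟩
    sum₂ (λ i j → 𝟙 (does (P? (f i , g j)))) ∎
    where open ≡-Reasoning

  sum-term : ∀ {n} (f : Fin n → ℕ) i → f i ≤ sum f
  sum-term f zero    = m≤m+n _ _
  sum-term f (suc i) = ≤-trans (sum-term (f ∘ suc) i) (m≤n+m _ (f zero))

  sumL-term : ∀ {n} k (F : List (Fin n) → ℕ) xs → length xs ≡ k → F xs ≤ sumL k F
  sumL-term zero    F []       refl = ≤-refl
  sumL-term (suc k) F (x ∷ xs) len  =
    ≤-trans (sumL-term k (F ∘ (x ∷_)) xs (suc-injective len)) (sum-term (λ v → sumL k (F ∘ (v ∷_))) x)

  -- Distinct values have disjoint fibres: setting `F` to zero on one fibre leaves the sums over the
  -- others intact.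
  sumL-fibres : ∀ {n} {B : Set} (_≟_ : DecidableEquality B) k z (φ : List (Fin n) → B) (F : List (Fin n) → ℕ)
    (ys : List B) → Unique ys → (∀ {y} → y ∈ ys → z ≤ sumL k (λ xs → F xs * 𝟙 (does (φ xs ≟ y)))) →
    length ys * z ≤ sumL k F
  sumL-fibres _≟_ k z φ F []       _          fibre≥ = z≤n
  sumL-fibres _≟_ k z φ F (y ∷ ys) (y∉ ∷ uniq) fibre≥ = begin
    z + length ys * z
      ≤⟨ +-mono-≤ (fibre≥ (here refl)) (sumL-fibres _≟_ k z φ F′ ys uniq fibre≥′) ⟩
    sumL k (λ xs → F xs * 𝟙 (does (φ xs ≟ y))) + sumL k F′
      ≡⟨ sumL-distrib-+ k (λ xs → F xs * 𝟙 (does (φ xs ≟ y))) F′ ⟨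
    sumL k (λ xs → F xs * 𝟙 (does (φ xs ≟ y)) + F′ xs)
      ≡⟨ sumL-cong k (λ xs _ → split (F xs) (does (φ xs ≟ y))) ⟩
    sumL k F ∎
    where
    open ≤-Reasoning
    F′ : List (Fin _) → ℕ
    F′ xs = F xs * 𝟙 (not (does (φ xs ≟ y)))
    split : ∀ f b → f * 𝟙 b + f * 𝟙 (not b) ≡ f
    split f true  = trans (cong₂ _+_ (*-identityʳ f) (*-zeroʳ f)) (+-identityʳ f)
    split f false = trans (cong₂ _+_ (*-zeroʳ f) (*-identityʳ f)) refl
    fibre≥′ : ∀ {y′} → y′ ∈ ys → z ≤ sumL k (λ xs → F′ xs * 𝟙 (does (φ xs ≟ y′)))
    fibre≥′ {y′} y′∈ = ≤-trans (fibre≥ (there y′∈)) (sumL-mono k (λ xs _ → same xs))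
      where
      same : ∀ xs → F xs * 𝟙 (does (φ xs ≟ y′)) ≤ F′ xs * 𝟙 (does (φ xs ≟ y′))
      same xs with φ xs ≟ y | φ xs ≟ y′
      ... | yes φ≡y | yes φ≡y′ = contradiction (trans (sym φ≡y) φ≡y′) (All.lookup y∉ y′∈)
      ... | no  _   | yes _    = ≤-reflexive (cong (_* 1) (sym (*-identityʳ (F xs))))
      ... | _       | no  _    = ≤-trans (≤-reflexive (*-zeroʳ (F xs))) z≤n

  -- The fibres of the identity, each a single tuple of weight at least 1.
  sumL-unique : ∀ {n} k (F : List (Fin n) → ℕ) (ys : List (List (Fin n))) → Unique ys →
    (∀ {y} → y ∈ ys → length y ≡ k × 1 ≤ F y) → length ys ≤ sumL k F
  sumL-unique k F ys uniq h = ≤-trans (≤-reflexive (sym (*-identityʳ _)))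
    (sumL-fibres (List.≡-dec Fin._≟_) k 1 (λ xs → xs) F ys uniq
      (λ {y} y∈ → ≤-trans (≤-trans (proj₂ (h y∈)) (≤-reflexive (sym (trans
          (cong (λ b → F y * 𝟙 b) (dec-true (List.≡-dec Fin._≟_ y y) refl)) (*-identityʳ (F y))))))
                          (sumL-term k (λ xs → F xs * 𝟙 (does (List.≡-dec Fin._≟_ xs y))) y (proj₁ (h y∈)))))

  allSubsets-unique : ∀ n → Unique (allSubsets n)
  allSubsets-unique zero    = All.[] ∷ []
  allSubsets-unique (suc n) =
    Unique.++⁺ (Unique.map⁺ Vec.∷-injectiveʳ (allSubsets-unique n)) (Unique.map⁺ Vec.∷-injectiveʳ (allSubsets-unique n))
      (λ (p , q) → disjoint p q)
    where
    disjoint : ∀ {S} → S ∈ List.map (inside Vec.∷_) (allSubsets n) → ¬ (S ∈ List.map (outside Vec.∷_) (allSubsets n))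
    disjoint p q with ∈-map⁻ (inside Vec.∷_) p | ∈-map⁻ (outside Vec.∷_) q
    ... | _ , _ , refl | _ , _ , ()

  T-does : ∀ {A : Set} (a? : Dec A) → A → T (does a?)
  T-does a? a = subst T (sym (dec-true a? a)) tt

  T-not-does : ∀ {A : Set} (a? : Dec A) → ¬ A → T (not (does a?))
  T-not-does a? ¬a = subst (T ∘ not) (sym (dec-false a? ¬a)) tt

  T-does⁻ : ∀ {A : Set} (a? : Dec A) → T (does a?) → A
  T-does⁻ (yes a) _ = a

  next-functional : ∀ {k} {a b b′ : Fin k} → Next a b → Next a b′ → b ≡ b′
  next-functional (inj₁ p)       (inj₁ q)       = Fin.toℕ-injective (trans p (sym q))
  next-functional (inj₂ (_ , p)) (inj₂ (_ , q)) = Fin.toℕ-injective (trans p (sym q))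
  next-functional {b = b} (inj₁ p) (inj₂ (q , _)) = contradiction (trans p q) (<⇒≢ (Fin.toℕ<n b))
  next-functional {b′ = b′} (inj₂ (q , _)) (inj₁ p) = contradiction (trans p q) (<⇒≢ (Fin.toℕ<n b′))

  next-injective : ∀ {k} {a a′ b : Fin k} → Next a b → Next a′ b → a ≡ a′
  next-injective (inj₁ p)       (inj₁ q)       = Fin.toℕ-injective (suc-injective (trans (sym p) q))
  next-injective (inj₂ (p , _)) (inj₂ (q , _)) = Fin.toℕ-injective (suc-injective (trans p (sym q)))
  next-injective (inj₁ p) (inj₂ (_ , q)) with () ← trans (sym p) q
  next-injective (inj₂ (_ , q)) (inj₁ p) with () ← trans (sym p) q

  ∈-irrelevant : ∀ {n} {S : Subset n} {x y : ∃[ v ] v Subset.∈ S} → proj₁ x ≡ proj₁ y → x ≡ y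
  ∈-irrelevant {x = v , p} {_ , q} refl = cong (v ,_) ([]=-irrelevant p q)

  -- The vertices i mod k of C k, i ∈ ℕ.
  module Winding (k : ℕ) .{{k≢0 : NonZero k}} (2<k : 2 < k) where

    toℕ-mod : ∀ i → toℕ (i mod k) ≡ i % k
    toℕ-mod i = Fin.toℕ-fromℕ< (m%n<n i k)

    mod-cong : ∀ {i j} → i % k ≡ j % k → i mod k ≡ j mod k
    mod-cong {i} {j} e = Fin.toℕ-injective (trans (toℕ-mod i) (trans e (sym (toℕ-mod j))))

    toℕ-%-mod : ∀ a → toℕ a mod k ≡ a
    toℕ-%-mod a = Fin.toℕ-injective (trans (toℕ-mod (toℕ a)) (m<n⇒m%n≡m (Fin.toℕ<n a)))

    %-+ˡ : ∀ d i → d < k → (d + i) % k ≡ (d + i % k) % k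
    %-+ˡ d i d<k = trans (%-distribˡ-+ d i k) (cong (λ z → (z + i % k) % k) (m<n⇒m%n≡m d<k))

    -- If d + (i mod k) stays below k, cancel i mod k; if it wraps around, agreement with i mod k
    -- would force d = k.
    %-shift-injective : ∀ d i → d < k → (d + i) % k ≡ i % k → d ≡ 0
    %-shift-injective d i d<k eq with d + i % k <? k
    ... | yes d+r<k = +-cancelʳ-≡ (i % k) d 0
      (trans (sym (m<n⇒m%n≡m d+r<k)) (trans (sym (%-+ˡ d i d<k)) eq))
    ... | no  d+r≮k with m≤n⇒∃[o]m+o≡n (≮⇒≥ d+r≮k)
    ... | e , k+e≡d+r = contradiction d<k (≤⇒≯ (≤-reflexive k≡d))
      where
      e<k : e < k
      e<k = +-cancelˡ-< k e k (<-≤-trans (≤-<-trans (≤-reflexive k+e≡d+r) (+-mono-< d<k (m%n<n i k))) ≤-refl)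
      e≡r : e ≡ i % k
      e≡r = begin
        e                  ≡⟨ m<n⇒m%n≡m e<k ⟨
        e % k              ≡⟨ [m+n]%n≡m%n e k ⟨
        (e + k) % k        ≡⟨ cong (_% k) (trans (+-comm e k) k+e≡d+r) ⟩
        (d + i % k) % k    ≡⟨ %-+ˡ d i d<k ⟨
        (d + i) % k        ≡⟨ eq ⟩
        i % k              ∎
        where open ≡-Reasoning
      k≡d : k ≡ d
      k≡d = +-cancelʳ-≡ (i % k) k d (trans (cong (k +_) (sym e≡r)) k+e≡d+r)

    next-mod : ∀ i → Next (i mod k) (suc i mod k)
    next-mod i with suc (i % k) <? k
    ... | yes s<k = inj₁ (begin
        toℕ (suc i mod k)    ≡⟨ toℕ-mod (suc i) ⟩
        suc i % k            ≡⟨ %-+ˡ 1 i (<-trans ≤-refl 2<k) ⟩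
        suc (i % k) % k      ≡⟨ m<n⇒m%n≡m s<k ⟩
        suc (i % k)          ≡⟨ cong suc (toℕ-mod i) ⟨
        suc (toℕ (i mod k))  ∎)
      where open ≡-Reasoning
    ... | no  s≮k = inj₂ (trans (cong suc (toℕ-mod i)) s≡k , (begin
        toℕ (suc i mod k)    ≡⟨ toℕ-mod (suc i) ⟩
        suc i % k            ≡⟨ %-+ˡ 1 i (<-trans ≤-refl 2<k) ⟩
        suc (i % k) % k      ≡⟨ cong (_% k) s≡k ⟩
        k % k                ≡⟨ n%n≡0 k ⟩
        0                    ∎))
      where
      open ≡-Reasoning
      s≡k : suc (i % k) ≡ k
      s≡k = ≤-antisym (m%n<n i k) (≮⇒≥ s≮k)

    next-mod⁻ : ∀ {i j} → Next (i mod k) (j mod k) → suc i % k ≡ j % k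
    next-mod⁻ {i} {j} nx = trans (sym (toℕ-mod (suc i)))
      (trans (cong toℕ (next-functional (next-mod i) nx)) (toℕ-mod j))

    -- Otherwise i + 2 would be i modulo k, against `2 < k`. This is what separates forward
    -- traversals from backward ones.
    ¬next-both : ∀ i → ¬ Next (suc i mod k) (i mod k)
    ¬next-both i nx with () ← %-shift-injective 2 i 2<k (next-mod⁻ nx)

    -- The reflection a ↦ k - 1 - a reverses the direction of the cycle and so supplies the backward
    -- traversals.
    next-opposite : ∀ {a b : Fin k} → Next a b → Next (opposite b) (opposite a)
    next-opposite {a} {b} (inj₁ b≡1+a) = inj₁ (begin
      toℕ (opposite a)        ≡⟨ Fin.opposite-prop a ⟩
      k ∸ suc (toℕ a)         ≡⟨ cong (k ∸_) b≡1+a ⟨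
      k ∸ toℕ b               ≡⟨ +-∸-assoc 1 (Fin.toℕ<n b) ⟩
      suc (k ∸ suc (toℕ b))   ≡⟨ cong suc (Fin.opposite-prop b) ⟨
      suc (toℕ (opposite b))  ∎)
      where open ≡-Reasoning
    next-opposite {a} {b} (inj₂ (1+a≡k , b≡0)) = inj₂
      ( trans (cong suc (Fin.opposite-prop b)) (trans (cong (λ z → suc (k ∸ suc z)) b≡0) (suc-pred k))
      , trans (Fin.opposite-prop a) (trans (cong (k ∸_) 1+a≡k) (n∸n≡0 k)) )

    module Ck = SimpleGraph (C k)

    ~-next : ∀ i → (i mod k) Ck.~ (suc i mod k)
    ~-next i = i≢ , inj₁ (next-mod i)
      where
      i≢ : i mod k ≢ suc i mod k
      i≢ e with () ← %-shift-injective 1 i (<-trans ≤-refl 2<k) (trans (sym (toℕ-mod (suc i)))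
        (trans (cong toℕ (sym e)) (toℕ-mod i)))

    -- The distance d + 2 lies between 2 and k - 2, so modulo k it is neither 1 nor -1.
    ≁-far : ∀ i d → suc (suc (suc d)) < k → ¬ ((i mod k) Ck.~ ((suc (suc d) + i) mod k))
    ≁-far i d d<k (_ , inj₁ nx) with () ← %-shift-injective (suc d) (suc i) (<-trans (n<1+n _) (<-trans (n<1+n _) d<k))
      (trans (cong (λ z → suc z % k) (+-suc d i)) (sym (next-mod⁻ nx)))
    ≁-far i d d<k (_ , inj₂ nx) with () ← %-shift-injective (suc (suc (suc d))) i d<k (next-mod⁻ {suc (suc d) + i} {i} nx)

    ~-opposite : ∀ {a b} → a Ck.~ b → opposite a Ck.~ opposite b
    ~-opposite {a} {b} (a≢b , nx) =
      (λ e → a≢b (trans (sym (Fin.opposite-involutive a)) (trans (cong opposite e) (Fin.opposite-involutive b))))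
      , swap (Sum.map next-opposite next-opposite nx)

    ~-opposite⁻ : ∀ {a b} → opposite a Ck.~ opposite b → a Ck.~ b
    ~-opposite⁻ {a} {b} p = subst₂ Ck._~_ (Fin.opposite-involutive a) (Fin.opposite-involutive b) (~-opposite p)

  -- A traversal is a window of a k-periodic sequence; changing the first vertex, or deleting a
  -- vertex and rotating, then only moves or shortens the window.
  run : ∀ {V : Set} → (ℕ → V) → ℕ → ℕ → List V
  run h zero    s = []
  run h (suc m) s = h s ∷ run h m (suc s)

  module _ {V : Set} (h : ℕ → V) where

    length-run : ∀ m s → length (run h m s) ≡ m
    length-run zero    s = refl
    length-run (suc m) s = cong suc (length-run m (suc s))

    run-++ : ∀ a b s → run h (a + b) s ≡ run h a s ++ run h b (a + s)
    run-++ zero    b s = refl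
    run-++ (suc a) b s = cong (h s ∷_) (trans (run-++ a b (suc s)) (cong (λ z → run h a (suc s) ++ run h b z) (+-suc a s)))

    run-period : ∀ {k} → (∀ i → h (k + i) ≡ h i) → ∀ m s → run h m (k + s) ≡ run h m s
    run-period     per zero    s = refl
    run-period {k} per (suc m) s = cong₂ _∷_ (per s) (trans (cong (run h m) (sym (+-suc k s))) (run-period per m (suc s)))

    ∈-run⁻ : ∀ {v} m s → v ∈ run h m s → ∃[ d ] d < m × v ≡ h (d + s)
    ∈-run⁻ (suc m) s (here refl) = 0 , z<s , refl
    ∈-run⁻ (suc m) s (there v∈) with ∈-run⁻ m (suc s) v∈
    ... | d , d<m , refl = suc d , s<s d<m , cong h (+-suc d s)

    ∈-run⁺ : ∀ m s d → d < m → h (d + s) ∈ run h m s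
    ∈-run⁺ (suc m) s zero    _         = here refl
    ∈-run⁺ (suc m) s (suc d) (s<s d<m) = there (subst (λ z → h z ∈ run h m (suc s)) (+-suc d s) (∈-run⁺ m (suc s) d d<m))

    ∈-run-period : ∀ {k} → (∀ i → h (k + i) ≡ h i) → ∀ s i → s < k → i < k → h i ∈ run h k s
    ∈-run-period {k} per s i s<k i<k with s ≤? i
    ... | yes s≤i = subst (λ z → h z ∈ run h k s) (m∸n+n≡m s≤i) (∈-run⁺ k s (i ∸ s) (≤-<-trans (m∸n≤m i s) i<k))
    ... | no  s≰i = subst (_∈ run h k s) (trans (cong h eq) (per i)) (∈-run⁺ k s (k + i ∸ s) lt)
      where
      eq : k + i ∸ s + s ≡ k + i
      eq = m∸n+n≡m (≤-trans (<⇒≤ s<k) (m≤m+n k i))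
      lt : k + i ∸ s < k
      lt = +-cancelʳ-< s _ k (≤-<-trans (≤-reflexive eq) (+-monoʳ-< k (≰⇒> s≰i)))

  module Copies {n : ℕ} (G : SimpleGraph (Fin n)) where

    private module G = SimpleGraph G

    adj : Fin n → Fin n → Bool
    adj u v = does (u G.~? v)

    adj-sym : ∀ u v → adj u v ≡ adj v u
    adj-sym u v = does-⇔ (mk⇔ G.~-sym G.~-sym) (u G.~? v) (v G.~? u)

    adj-irrefl : ∀ u → adj u u ≡ false
    adj-irrefl u = dec-false (u G.~? u) G.~-irrefl

    open Paths adj adj-sym adj-irrefl public

    edges≡∣E∣ : edges ≡ ∣E G ∣
    edges≡∣E∣ = sym (trans (length-filter-product (λ (u , v) → (u Fin.<? v) ×-dec (u G.~? v)) (λ i → i) (λ i → i))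
      (sum₂-cong (λ u v → 𝟙-∧ (u <ᵇ′ v) (adj u v))))
      where
      𝟙-∧ : ∀ a b → 𝟙 (a ∧ b) ≡ 𝟙 a * 𝟙 b
      𝟙-∧ true  b = sym (+-identityʳ (𝟙 b))
      𝟙-∧ false b = refl

    ∏-ones : ∀ {m} {f : Fin m → ℕ} → (∀ i → f i ≡ 1) → ∏ f ≡ 1
    ∏-ones {zero}  f≡1 = refl
    ∏-ones {suc m} f≡1 = cong₂ _*_ (f≡1 zero) (∏-ones (f≡1 ∘ suc))

    module _ {k : ℕ} (h : ℕ → Fin n) (period : ∀ i → h (k + i) ≡ h i)
             (near : ∀ i → T (adj (h i) (h (suc i))))
             (far : ∀ i d → suc (suc (suc d)) < k → T (not (adj (h i) (h (suc (suc d) + i))))) where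

      nonadj-run : ∀ {x} m t → (∀ d → d < m → T (not (adj x (h (d + t))))) → T (nonadj x (run h m t))
      nonadj-run zero    t x≁ = tt
      nonadj-run {x} (suc m) t x≁ = ∧-intro (x≁ 0 z<s)
        (nonadj-run m (suc t) (λ d d<m → subst (λ z → T (not (adj x (h z)))) (sym (+-suc d t)) (x≁ (suc d) (s<s d<m))))

      -- Among fewer than k consecutive terms, two that are at least 2 apart are at most k - 2
      -- apart, where `far` applies.
      path-run : ∀ m t → m < k → T (path (run h m t))
      path-run zero          t m<k = tt
      path-run (suc zero)    t m<k = tt
      path-run (suc (suc m)) t m<k = ∧-intro (near t) (∧-intro
        (nonadj-run m (suc (suc t)) (λ d d<m →
          subst (λ z → T (not (adj (h t) (h z)))) (sym (trans (+-suc d (suc t)) (cong suc (+-suc d t))))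
            (far t d (≤-<-trans (s≤s (s≤s d<m)) m<k))))
        (path-run (suc m) (suc t) (<-trans (n<1+n _) m<k)))

      -- By periodicity, deleting the vertex in position i and rotating leaves the window of k - 1
      -- terms that starts at i + 1 + s.
      cycle-run : ∀ s → cycle k (run h k s) ≡ 1
      cycle-run s = ∏-ones (λ i → 𝟙-T (deleted (toℕ i) (Fin.toℕ<n i)))
        where
        deleted : ∀ i → i < k → T (path (drop (suc i) (run h k s) ++ take i (run h k s)))
        deleted i i<k with m≤n⇒∃[o]m+o≡n i<k
        ... | b , 1+i+b≡k = subst (T ∘ path) (sym (begin
          drop (suc i) (run h k s) ++ take i (run h k s)
            ≡⟨ cong (λ xs → drop (suc i) xs ++ take i xs)
                 (trans (cong (λ m → run h m s) (sym i+1+b≡k)) (run-++ h i (suc b) s)) ⟩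
          drop (suc i) (u ++ v ∷ w) ++ take i (u ++ v ∷ w)
            ≡⟨ cong (λ l → drop (suc l) (u ++ v ∷ w) ++ take l (u ++ v ∷ w)) (length-run h i s) ⟨
          drop (suc (length u)) (u ++ v ∷ w) ++ take (length u) (u ++ v ∷ w)
            ≡⟨ drop-suc-take-++ u v w ⟩
          w ++ u
            ≡⟨ cong (w ++_) (run-period h period i s) ⟨
          w ++ run h i (k + s)
            ≡⟨ cong (λ z → w ++ run h i z) (trans (cong (_+ s) (trans (sym 1+i+b≡k) (+-comm (suc i) b))) (+-assoc b (suc i) s)) ⟩
          w ++ run h i (b + suc (i + s))
            ≡⟨ run-++ h b i (suc (i + s)) ⟨
          run h (b + i) (suc (i + s)) ∎))
          (path-run (b + i) (suc (i + s)) (≤-reflexive (trans (cong suc (+-comm b i)) 1+i+b≡k)))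
          where
          open ≡-Reasoning
          i+1+b≡k = trans (+-suc i b) 1+i+b≡k
          u = run h i s
          v = h (i + s)
          w = run h b (suc (i + s))

    support : List (Fin n) → Subset n
    support xs = Vec.tabulate (λ v → does (DecMembership._∈?_ Fin._≟_ v xs))

    support-≡ : ∀ xs (S : Subset n) → (∀ {v} → v ∈ xs → v Subset.∈ S) → (∀ {v} → v Subset.∈ S → v ∈ xs) →
                support xs ≡ S
    support-≡ xs S to from = trans (Vec.tabulate-cong agree) (Vec.tabulate∘lookup S)
      where
      agree : ∀ v → does (DecMembership._∈?_ Fin._≟_ v xs) ≡ Vec.lookup S v
      agree v with DecMembership._∈?_ Fin._≟_ v xs | Vec.lookup S v in eq
      ... | yes v∈ | b     = trans (sym (Vec.[]=⇒lookup (to v∈))) eq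
      ... | no  v∉ | true  = contradiction (from (Vec.lookup⇒[]= v S eq)) v∉
      ... | no  v∉ | false = refl

    _≟ₛ_ : DecidableEquality (Subset n)
    _≟ₛ_ = Vec.≡-dec Bool._≟_

    module _ (k : ℕ) .{{k≢0 : NonZero k}} (2<k : 2 < k) where

      open Winding k 2<k

      cycles-on : Subset n → List (Fin n) → ℕ
      cycles-on S xs = cycle k xs * 𝟙 (does (support xs ≟ₛ S))

      module _ (S : Subset n) (iso : induced G S ≅ C k) where

        open _≅_ iso
        open Inverse bijection

        f : Fin k → Fin n
        f a = proj₁ (from a)

        f-surjective : ∀ {v} → v Subset.∈ S → ∃[ a ] f a ≡ v
        f-surjective {v} v∈S = to (v , v∈S) , cong proj₁ (strictlyInverseʳ (v , v∈S))

        f-injective : ∀ {a b} → f a ≡ f b → a ≡ b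
        f-injective {a} {b} e = trans (sym (strictlyInverseˡ a)) (trans
          (cong to (∈-irrelevant {x = from a} {from b} e)) (strictlyInverseˡ b))

        f-adj : ∀ {a b} → a Ck.~ b → T (adj (f a) (f b))
        f-adj {a} {b} a~b = T-does (f a G.~? f b)
          (Equivalence.from (adjacency (from a) (from b))
            (subst₂ Ck._~_ (sym (strictlyInverseˡ a)) (sym (strictlyInverseˡ b)) a~b))

        f-nonadj : ∀ {a b} → ¬ (a Ck.~ b) → T (not (adj (f a) (f b)))
        f-nonadj {a} {b} a≁b = T-not-does (f a G.~? f b) (λ fa~fb → a≁b
          (subst₂ Ck._~_ (strictlyInverseˡ a) (strictlyInverseˡ b)
            (Equivalence.to (adjacency (from a) (from b)) fa~fb)))

        forward backward : ℕ → Fin n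
        forward  i = f (i mod k)
        backward i = f (opposite (i mod k))

        mod-period : ∀ i → (k + i) mod k ≡ i mod k
        mod-period i = mod-cong (trans (cong (_% k) (+-comm k i)) ([m+n]%n≡m%n i k))

        on-S : ∀ (h : ℕ → Fin n) → (∀ i → h (k + i) ≡ h i) → (∀ i → h i Subset.∈ S) →
               (∀ {v} → v Subset.∈ S → ∃[ i ] i < k × h i ≡ v) → ∀ {s} → s < k → support (run h k s) ≡ S
        on-S h per h∈S onto {s} s<k = support-≡ (run h k s) S in-S from-S
          where
          in-S : ∀ {v} → v ∈ run h k s → v Subset.∈ S
          in-S v∈ with ∈-run⁻ h k s v∈
          ... | d , _ , refl = h∈S (d + s)
          from-S : ∀ {v} → v Subset.∈ S → v ∈ run h k s
          from-S v∈S with onto v∈S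
          ... | i , i<k , refl = ∈-run-period h per s i s<k i<k

        runs : List (List (Fin n))
        runs = applyUpTo (run forward k) k ++ applyUpTo (run backward k) k

        run-head : ∀ {m s s′} {h h′ : ℕ → Fin n} → 2 < m → run h m s ≡ run h′ m s′ → h s ≡ h′ s′ × h (suc s) ≡ h′ (suc s′)
        run-head (s<s (s<s _)) e = List.∷-injectiveˡ e , List.∷-injectiveˡ (List.∷-injectiveʳ e)

        -- The first vertex tells apart runs in the same direction; the first two vertices together
        -- tell apart the two directions.
        runs-unique : Unique runs
        runs-unique = Unique.++⁺
          (Unique.applyUpTo⁺₁ (run forward k) k (λ i<j j<k e →
            distinct i<j j<k (f-injective (proj₁ (run-head 2<k e)))))
          (Unique.applyUpTo⁺₁ (run backward k) k (λ i<j j<k e →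
            distinct i<j j<k (opposite-injective (f-injective (proj₁ (run-head 2<k e))))))
          (λ (p , q) → disjoint p q)
          where
          opposite-injective : ∀ {a b : Fin k} → opposite a ≡ opposite b → a ≡ b
          opposite-injective {a} {b} e =
            trans (sym (Fin.opposite-involutive a)) (trans (cong opposite e) (Fin.opposite-involutive b))
          distinct : ∀ {i j} → i < j → j < k → i mod k ≢ j mod k
          distinct {i} {j} i<j j<k e = <⇒≢ i<j (begin
            i            ≡⟨ m<n⇒m%n≡m (<-trans i<j j<k) ⟨
            i % k        ≡⟨ toℕ-mod i ⟨
            toℕ (i mod k) ≡⟨ cong toℕ e ⟩
            toℕ (j mod k) ≡⟨ toℕ-mod j ⟩
            j % k        ≡⟨ m<n⇒m%n≡m j<k ⟩
            j            ∎)
            where open ≡-Reasoning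
          disjoint : ∀ {xs} → xs ∈ applyUpTo (run forward k) k → ¬ (xs ∈ applyUpTo (run backward k) k)
          disjoint p q with ∈-applyUpTo⁻ (run forward k) p | ∈-applyUpTo⁻ (run backward k) q
          ... | s , _ , refl | s′ , _ , e with run-head 2<k e
          ... | e₀ , e₁ = ¬next-both s (subst₂ Next (sym (f-injective e₁)) (sym (f-injective e₀)) (next-opposite (next-mod s′)))

        runs-cycles : ∀ {xs} → xs ∈ runs → length xs ≡ k × 1 ≤ cycles-on S xs
        runs-cycles {xs} p = [ forwards , backwards ]′ (∈-++⁻ (applyUpTo (run forward k) k) p)
          where
          good : ∀ {h s} → cycle k (run h k s) ≡ 1 → support (run h k s) ≡ S → 1 ≤ cycles-on S (run h k s)
          good {h} {s} cyc supp = ≤-reflexive (sym (cong₂ _*_ cyc (cong 𝟙 (dec-true (support (run h k s) ≟ₛ S) supp))))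
          forwards : xs ∈ applyUpTo (run forward k) k → length xs ≡ k × 1 ≤ cycles-on S xs
          forwards q with ∈-applyUpTo⁻ (run forward k) q
          ... | s , s<k , refl = length-run forward k s , good
            (cycle-run forward (cong f ∘ mod-period) (f-adj ∘ ~-next) (λ i d d<k → f-nonadj (≁-far i d d<k)) s)
            (on-S forward (cong f ∘ mod-period) (λ i → proj₂ (from (i mod k))) onto s<k)
            where
            onto : ∀ {v} → v Subset.∈ S → ∃[ i ] i < k × forward i ≡ v
            onto v∈S with f-surjective v∈S
            ... | a , refl = toℕ a , Fin.toℕ<n a , cong f (toℕ-%-mod a)
          backwards : xs ∈ applyUpTo (run backward k) k → length xs ≡ k × 1 ≤ cycles-on S xs
          backwards q with ∈-applyUpTo⁻ (run backward k) q
          ... | s , s<k , refl = length-run backward k s , good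
            (cycle-run backward (cong (f ∘ opposite) ∘ mod-period) (f-adj ∘ ~-opposite ∘ ~-next)
              (λ i d d<k → f-nonadj (≁-far i d d<k ∘ ~-opposite⁻)) s)
            (on-S backward (cong (f ∘ opposite) ∘ mod-period) (λ i → proj₂ (from (opposite (i mod k)))) onto s<k)
            where
            onto : ∀ {v} → v Subset.∈ S → ∃[ i ] i < k × backward i ≡ v
            onto v∈S with f-surjective v∈S
            ... | a , refl = toℕ (opposite a) , Fin.toℕ<n (opposite a)
              , cong f (trans (cong opposite (toℕ-%-mod (opposite a))) (Fin.opposite-involutive a))

        2k≤cycles-on : k + k ≤ sumL k (cycles-on S)
        2k≤cycles-on = ≤-trans (≤-reflexive (sym length-runs)) (sumL-unique k (cycles-on S) runs runs-unique runs-cycles)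
          where
          length-runs : length runs ≡ k + k
          length-runs = trans (List.length-++ (applyUpTo (run forward k) k))
            (cong₂ _+_ (List.length-applyUpTo (run forward k) k) (List.length-applyUpTo (run backward k) k))

      -- A traversal determines its copy as its support, so the copies index disjoint fibres with at
      -- least 2k tuples each.
      copies-bound : c G (C k) * (k + k) ≤ sumL k (cycle k)
      copies-bound = sumL-fibres _≟ₛ_ k (k + k) support (cycle k) (filter (induced≅? G (C k)) (allSubsets n))
        (Unique.filter⁺ (induced≅? G (C k)) (allSubsets-unique n))
        (λ {S} S∈ → 2k≤cycles-on S (proj₂ (∈-filter⁻ (induced≅? G (C k)) {xs = allSubsets n} S∈)))

  -- The equations translate from `2 + j`, `suc j` and `(2 + j) * 2`, in which the induction is
  -- phrased, to l, l - 1 and 2l.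
  copies-odd-cycle-≤ : ∀ {n} (G : SimpleGraph (Fin n)) j {l t d} → l ≡ 2 + j → t ≡ suc j → d ≡ l * 2 →
    (c G (C (suc d)) * (suc d + suc d)) ^ d * (t ^ t) ^ suc d ≤ (∣E G ∣ ^ l) ^ suc d
  copies-odd-cycle-≤ G j {d = d} refl refl d≡ = begin
    (c G (C (suc d)) * (suc d + suc d)) ^ d * (suc j ^ suc j) ^ suc d
      ≤⟨ *-monoˡ-≤ ((suc j ^ suc j) ^ suc d)
           (^-monoˡ-≤ d (copies-bound (suc d) (s≤s (≤-trans (s≤s (s≤s z≤n)) (≤-reflexive (sym d≡)))))) ⟩
    sumL (suc d) (cycle (suc d)) ^ d * (suc j ^ suc j) ^ suc d
      ≤⟨ subst (λ d → sumL (suc d) (cycle (suc d)) ^ d * (suc j ^ suc j) ^ suc d ≤ (edges ^ (2 + j)) ^ suc d)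
           (sym d≡) (cycles-bound j) ⟩
    (edges ^ (2 + j)) ^ suc d
      ≡⟨ cong (λ m → (m ^ (2 + j)) ^ suc d) edges≡∣E∣ ⟩
    (∣E G ∣ ^ (2 + j)) ^ suc d ∎
    where
    open ≤-Reasoning
    open Copies G

  -- Blow-ups of cycles

  index-injective : ∀ {A : Set} {x y : A} {xs} (p : x ∈ xs) (q : y ∈ xs) → index p ≡ index q → x ≡ y
  index-injective {xs = xs} p q e = trans (lookup-index p) (trans (cong (List.lookup xs) e) (sym (lookup-index q)))

  lookup-injective : ∀ {A : Set} {xs : List A} → Unique xs → ∀ {i j} → List.lookup xs i ≡ List.lookup xs j → i ≡ j
  lookup-injective (x∉ ∷ u) {zero}  {zero}  e = refl
  lookup-injective (x∉ ∷ u) {zero}  {suc j} e = contradiction e (All.lookup x∉ (∈-lookup j))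
  lookup-injective (x∉ ∷ u) {suc i} {zero}  e = contradiction (sym e) (All.lookup x∉ (∈-lookup i))
  lookup-injective (x∉ ∷ u) {suc i} {suc j} e = cong suc (lookup-injective u e)

  unique-⊆⇒length-≤ : ∀ {A : Set} {xs ys : List A} → Unique xs → xs ⊆ ys → length xs ≤ length ys
  unique-⊆⇒length-≤ {xs = xs} u xs⊆ys = Fin.injective⇒≤ {f = λ i → index (xs⊆ys (∈-lookup {xs = xs} i))}
    (λ e → lookup-injective u (index-injective (xs⊆ys (∈-lookup {xs = xs} _)) (xs⊆ys (∈-lookup {xs = xs} _)) e))

  ∈-allSubsets : ∀ {n} (S : Subset n) → S ∈ allSubsets n
  ∈-allSubsets []            = here refl
  ∈-allSubsets (true  ∷ S) = ∈-++⁺ˡ (∈-map⁺ (inside ∷_) (∈-allSubsets S))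
  ∈-allSubsets (false ∷ S) = ∈-++⁺ʳ _ (∈-map⁺ (outside ∷_) (∈-allSubsets S))

  allVecs : ∀ s k → List (Vec (Fin s) k)
  allVecs s zero    = [] ∷ []
  allVecs s (suc k) = cartesianProductWith _∷_ (allFin s) (allVecs s k)

  allVecs-unique : ∀ s k → Unique (allVecs s k)
  allVecs-unique s zero    = All.[] ∷ []
  allVecs-unique s (suc k) = Unique.cartesianProductWith⁺ _∷_ Vec.∷-injective (Unique.allFin⁺ s) (allVecs-unique s k)

  length-cartesianProductWith : ∀ {A B C : Set} (f : A → B → C) xs ys →
    length (cartesianProductWith f xs ys) ≡ length xs * length ys
  length-cartesianProductWith f []       ys = refl
  length-cartesianProductWith f (x ∷ xs) ys = trans (List.length-++ (List.map (f x) ys))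
    (cong₂ _+_ (List.length-map (f x) ys) (length-cartesianProductWith f xs ys))

  length-allVecs : ∀ s k → length (allVecs s k) ≡ s ^ k
  length-allVecs s zero    = refl
  length-allVecs s (suc k) = trans (length-cartesianProductWith _∷_ (allFin s) (allVecs s k))
    (cong₂ _*_ (List.length-tabulate {n = s} (λ i → i)) (length-allVecs s k))

  -- s^k induced k-cycles of G, one for each choice of one vertex in each of k parts of size s.
  record Transversals {n} (G : SimpleGraph (Fin n)) (k s : ℕ) : Set where
    open SimpleGraph G
    field
      vertex           : Vec (Fin s) k → Fin k → Fin n
      vertex-injective : ∀ g g′ a b → vertex g a ≡ vertex g′ b → a ≡ b × lookup g a ≡ lookup g′ a
      vertex-adj       : ∀ g a b → (vertex g a ~ vertex g b) ⇔ SimpleGraph._~_ (C k) a b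

  module _ {n k} (G : SimpleGraph (Fin n)) (f : Fin k → Fin n) where

    private module G = SimpleGraph G

    image : Subset n
    image = Vec.tabulate (λ v → does (Fin.any? (λ a → f a Fin.≟ v)))

    ∈-image⁺ : ∀ a → f a Subset.∈ image
    ∈-image⁺ a = Vec.lookup⇒[]= (f a) image (trans (Vec.lookup∘tabulate _ (f a))
      (dec-true (Fin.any? (λ b → f b Fin.≟ f a)) (a , refl)))

    ∈-image⁻ : ∀ {v} → v Subset.∈ image → ∃[ a ] f a ≡ v
    ∈-image⁻ {v} v∈ = T-does⁻ (Fin.any? (λ a → f a Fin.≟ v))
      (subst T (sym (trans (sym (Vec.lookup∘tabulate _ v)) (Vec.[]=⇒lookup v∈))) tt)

    induced-image : (∀ {a b} → f a ≡ f b → a ≡ b) → (∀ a b → (f a G.~ f b) ⇔ SimpleGraph._~_ (C k) a b) →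
                    induced G image ≅ C k
    induced-image inj adj = record
      { bijection = mk↔ₛ′ to from (λ a → inj (proj₂ (∈-image⁻ (∈-image⁺ a)))) (λ (v , v∈) → ∈-irrelevant (proj₂ (∈-image⁻ v∈)))
      ; adjacency = λ (u , u∈) (v , v∈) → subst₂ (λ x y → (x G.~ y) ⇔ SimpleGraph._~_ (C k) (to (u , u∈)) (to (v , v∈)))
          (proj₂ (∈-image⁻ u∈)) (proj₂ (∈-image⁻ v∈)) (adj _ _)
      }
      where
      to : ∃[ v ] v Subset.∈ image → Fin k
      to (v , v∈) = proj₁ (∈-image⁻ v∈)
      from : Fin k → ∃[ v ] v Subset.∈ image
      from a = f a , ∈-image⁺ a

  -- The vertex set determines the choice: its member from part a can only arise from part a of any
  -- other choice with the same set.
  transversals-≤ : ∀ {n k s} (G : SimpleGraph (Fin n)) → Transversals G k s → s ^ k ≤ c G (C k)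
  transversals-≤ {n} {k} {s} G t = ≤-trans (≤-reflexive (sym (trans (List.length-map S (allVecs s k)) (length-allVecs s k))))
    (unique-⊆⇒length-≤ (Unique.map⁺ S-injective (allVecs-unique s k)) S-copies)
    where
    open Transversals t
    S : Vec (Fin s) k → Subset n
    S g = image G (vertex g)
    S-copies : List.map S (allVecs s k) ⊆ filter (induced≅? G (C k)) (allSubsets n)
    S-copies S∈ with ∈-map⁻ S S∈
    ... | g , _ , refl = ∈-filter⁺ (induced≅? G (C k)) (∈-allSubsets (S g))
      (induced-image G (vertex g) (λ e → proj₁ (vertex-injective g g _ _ e)) (vertex-adj g))
    S-injective : ∀ {g g′} → S g ≡ S g′ → g ≡ g′
    S-injective {g} {g′} e = trans (sym (Vec.tabulate∘lookup g)) (trans (Vec.tabulate-cong same) (Vec.tabulate∘lookup g′))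
      where
      same : ∀ a → lookup g a ≡ lookup g′ a
      same a with ∈-image⁻ G (vertex g′) (subst (vertex g a Subset.∈_) e (∈-image⁺ G (vertex g) a))
      ... | b , e′ = proj₂ (vertex-injective g g′ a b (sym e′))

  2∣E∣≡arcs : ∀ {n} (G : SimpleGraph (Fin n)) → 2 * ∣E G ∣ ≡ sum₂ (λ u v → 𝟙 (does (SimpleGraph._~?_ G u v)))
  2∣E∣≡arcs G = sym (trans arcs≡2edges (cong (2 *_) edges≡∣E∣))
    where open Copies G

  module _ {n} (G : SimpleGraph (Fin n)) where

    private module G = SimpleGraph G

    -- The added edge lies on two fresh vertices, so the subgraphs induced on old vertices do not
    -- change.
    data AddEdge : Fin (2 + n) → Fin (2 + n) → Set where
      new  : AddEdge zero (suc zero)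
      new′ : AddEdge (suc zero) zero
      old  : ∀ {u v} → u G.~ v → AddEdge (suc (suc u)) (suc (suc v))

    addEdge : SimpleGraph (Fin (2 + n))
    addEdge = record { _~_ = AddEdge ; _~?_ = dec ; ~-sym = symm ; ~-irrefl = irr }
      where
      dec : Decidable AddEdge
      dec zero          zero          = no λ ()
      dec zero          (suc zero)    = yes new
      dec zero          (suc (suc _)) = no λ ()
      dec (suc zero)    zero          = yes new′
      dec (suc zero)    (suc _)       = no λ ()
      dec (suc (suc _)) zero          = no λ ()
      dec (suc (suc _)) (suc zero)    = no λ ()
      dec (suc (suc u)) (suc (suc v)) with u G.~? v
      ... | yes u~v = yes (old u~v)
      ... | no  u≁v = no λ { (old u~v) → u≁v u~v }
      symm : ∀ {u v} → AddEdge u v → AddEdge v u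
      symm new       = new′
      symm new′      = new
      symm (old u~v) = old (G.~-sym u~v)
      irr : ∀ {v} → ¬ AddEdge v v
      irr (old v~v) = G.~-irrefl v~v

    ∣E-addEdge∣ : ∣E addEdge ∣ ≡ suc ∣E G ∣
    ∣E-addEdge∣ = *-cancelˡ-≡ _ _ 2 (begin
      2 * ∣E addEdge ∣
        ≡⟨ 2∣E∣≡arcs addEdge ⟩
      (1 + sum {n} (λ _ → 0)) + ((1 + sum {n} (λ _ → 0)) +
        sum₂ (λ u v → 𝟙 (does (SimpleGraph._~?_ addEdge (suc (suc u)) (suc (suc v))))))
        ≡⟨ cong (λ z → (1 + z) + ((1 + z) + sum₂ (λ u v → 𝟙 (does (SimpleGraph._~?_ addEdge (suc (suc u)) (suc (suc v)))))))
             (sum-replicate-zero n) ⟩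
      2 + sum₂ (λ u v → 𝟙 (does (SimpleGraph._~?_ addEdge (suc (suc u)) (suc (suc v)))))
        ≡⟨ cong (2 +_) (sum₂-cong old-arc) ⟩
      2 + sum₂ (λ u v → 𝟙 (does (u G.~? v)))
        ≡⟨ cong (2 +_) (2∣E∣≡arcs G) ⟨
      2 + 2 * ∣E G ∣
        ≡⟨ *-suc 2 ∣E G ∣ ⟨
      2 * suc ∣E G ∣ ∎)
      where
      open ≡-Reasoning
      old-arc : ∀ u v → 𝟙 (does (SimpleGraph._~?_ addEdge (suc (suc u)) (suc (suc v)))) ≡ 𝟙 (does (u G.~? v))
      old-arc u v with u G.~? v
      ... | yes _ = refl
      ... | no  _ = refl

    addEdge-transversals : ∀ {k s} → Transversals G k s → Transversals addEdge k s
    addEdge-transversals t = record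
      { vertex           = λ g a → suc (suc (vertex g a))
      ; vertex-injective = λ g g′ a b e → vertex-injective g g′ a b (Fin.suc-injective (Fin.suc-injective e))
      ; vertex-adj       = λ g a b → mk⇔ (λ { (old p) → Equivalence.to (vertex-adj g a b) p })
                                         (λ p → old (Equivalence.from (vertex-adj g a b) p))
      }
      where open Transversals t

  addEdges : ∀ {n k s} t (G : SimpleGraph (Fin n)) → Transversals G k s →
             ∃[ n′ ] Σ[ G′ ∈ SimpleGraph (Fin n′) ] (∣E G′ ∣ ≡ t + ∣E G ∣ × Transversals G′ k s)
  addEdges zero    G tr = _ , G , refl , tr
  addEdges (suc t) G tr with addEdges t G tr
  ... | n′ , G′ , E≡ , tr′ = _ , addEdge G′ , trans (∣E-addEdge∣ G′) (cong suc E≡) , addEdge-transversals G′ tr′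

  sum-const : ∀ n z → sum {n} (λ _ → z) ≡ n * z
  sum-const zero    z = refl
  sum-const (suc n) z = cong (z +_) (sum-const n z)

  sum-split : ∀ m {n} (f : Fin (m + n) → ℕ) → sum f ≡ sum (λ i → f (i ↑ˡ n)) + sum (λ i → f (m ↑ʳ i))
  sum-split zero    f = refl
  sum-split (suc m) f = trans (cong (f zero +_) (sum-split m (f ∘ suc))) (sym (+-assoc (f zero) _ _))

  sum-combine : ∀ k s (f : Fin (k * s) → ℕ) → sum f ≡ sum₂ (λ a i → f (combine {k} {s} a i))
  sum-combine zero    s f = refl
  sum-combine (suc k) s f = trans (sum-split s f) (cong (sum (λ i → f (i ↑ˡ k * s)) +_) (sum-combine k s (λ i → f (s ↑ʳ i))))

  sum-𝟙≤1 : ∀ {n} (p : Fin n → Bool) → (∀ i j → T (p i) → T (p j) → i ≡ j) → sum (λ i → 𝟙 (p i)) ≤ 1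
  sum-𝟙≤1 {zero}  p unique = z≤n
  sum-𝟙≤1 {suc n} p unique with p zero in eq
  ... | false = sum-𝟙≤1 (p ∘ suc) (λ i j pi pj → Fin.suc-injective (unique (suc i) (suc j) pi pj))
  ... | true  = s≤s (≤-trans (sum-mono others) (≤-reflexive (sum-replicate-zero n)))
    where
    others : ∀ i → 𝟙 (p (suc i)) ≤ 0
    others i with p (suc i) in eqᵢ
    ... | false = z≤n
    ... | true with () ← unique zero (suc i) (subst T (sym eq) tt) (subst T (sym eqᵢ) tt)

  next? : ∀ {k} → Decidable (Next {k})
  next? {k} i j = (toℕ j ≟ suc (toℕ i)) ⊎-dec ((suc (toℕ i) ≟ k) ×-dec (toℕ j ≟ 0))

  -- `Next` is functional and injective, so a vertex has at most one successor and one predecessor.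
  degree-C : ∀ {k} (a : Fin k) → sum (λ b → 𝟙 (does (SimpleGraph._~?_ (C k) a b))) ≤ 2
  degree-C {k} a = begin
    sum (λ b → 𝟙 (does (a ~? b)))
      ≤⟨ sum-mono neighbour ⟩
    sum (λ b → 𝟙 (does (next? a b)) + 𝟙 (does (next? b a)))
      ≡⟨ ∑-distrib-+ (λ b → 𝟙 (does (next? a b))) (λ b → 𝟙 (does (next? b a))) ⟩
    sum (λ b → 𝟙 (does (next? a b))) + sum (λ b → 𝟙 (does (next? b a)))
      ≤⟨ +-mono-≤ (sum-𝟙≤1 _ (λ b b′ p q → next-functional (T-does⁻ (next? a b) p) (T-does⁻ (next? a b′) q)))
                  (sum-𝟙≤1 _ (λ b b′ p q → next-injective (T-does⁻ (next? b a) p) (T-does⁻ (next? b′ a) q))) ⟩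
    2 ∎
    where
    open ≤-Reasoning
    open SimpleGraph (C k)
    neighbour : ∀ b → 𝟙 (does (a ~? b)) ≤ 𝟙 (does (next? a b)) + 𝟙 (does (next? b a))
    neighbour b = bound (a ~? b)
      where
      bound : (d : Dec (a ~ b)) → 𝟙 (does d) ≤ 𝟙 (does (next? a b)) + 𝟙 (does (next? b a))
      bound (no _) = z≤n
      bound (yes (_ , inj₁ nx)) = ≤-trans (≤-reflexive (sym (cong 𝟙 (dec-true (next? a b) nx)))) (m≤m+n _ _)
      bound (yes (_ , inj₂ nx)) = ≤-trans (≤-reflexive (sym (cong 𝟙 (dec-true (next? b a) nx)))) (m≤n+m _ _)

  module _ (k s : ℕ) where

    private module Ck = SimpleGraph (C k)

    part : Fin (k * s) → Fin k
    part = quotient {k} s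

    part-combine : ∀ a i → part (combine a i) ≡ a
    part-combine a i = cong proj₁ (Fin.remQuot-combine {k} {s} a i)

    blowup : SimpleGraph (Fin (k * s))
    blowup = record
      { _~_      = λ u v → part u Ck.~ part v
      ; _~?_     = λ u v → part u Ck.~? part v
      ; ~-sym    = Ck.~-sym
      ; ~-irrefl = Ck.~-irrefl
      }

    -- Degree sum: a vertex sees at most two parts, hence at most 2s vertices. Edges short of m are
    -- supplied by padding.
    ∣E-blowup∣ : ∣E blowup ∣ ≤ k * s * s
    ∣E-blowup∣ = *-cancelˡ-≤ 2 (begin
      2 * ∣E blowup ∣
        ≡⟨ 2∣E∣≡arcs blowup ⟩
      sum₂ (λ u v → 𝟙 (does (part u Ck.~? part v)))
        ≤⟨ sum-mono degree ⟩
      sum {k * s} (λ _ → 2 * s)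
        ≡⟨ sum-const (k * s) (2 * s) ⟩
      k * s * (2 * s)
        ≡⟨ eq (k * s) s ⟩
      2 * (k * s * s) ∎)
      where
      open ≤-Reasoning
      eq : ∀ a s → a * (2 * s) ≡ 2 * (a * s)
      eq = solve-∀
      degree : ∀ u → sum (λ v → 𝟙 (does (part u Ck.~? part v))) ≤ 2 * s
      degree u = begin
        sum (λ v → 𝟙 (does (part u Ck.~? part v)))
          ≡⟨ sum-combine k s _ ⟩
        sum₂ (λ b j → 𝟙 (does (part u Ck.~? part (combine {k} {s} b j))))
          ≡⟨ sum-cong-≗ (λ b → trans (sum-cong-≗ (λ j → cong (λ z → 𝟙 (does (part u Ck.~? z))) (part-combine b j)))
                                     (trans (sum-const s _) (*-comm s _))) ⟩
        sum (λ b → 𝟙 (does (part u Ck.~? b)) * s)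
          ≡⟨ *-distribʳ-sum s (λ b → 𝟙 (does (part u Ck.~? b))) ⟨
        sum (λ b → 𝟙 (does (part u Ck.~? b))) * s
          ≤⟨ *-monoˡ-≤ s (degree-C (part u)) ⟩
        2 * s ∎

    blowup-transversals : Transversals blowup k s
    blowup-transversals = record
      { vertex           = λ g a → combine a (lookup g a)
      ; vertex-injective = inj
      ; vertex-adj       = λ g a b → subst₂ (λ x y → (x Ck.~ y) ⇔ (a Ck.~ b))
          (sym (part-combine a (lookup g a))) (sym (part-combine b (lookup g b))) (mk⇔ (λ p → p) (λ p → p))
      }
      where
      inj : ∀ g g′ a b → combine a (lookup g a) ≡ combine b (lookup g′ b) → a ≡ b × lookup g a ≡ lookup g′ a
      inj g g′ a b e with Fin.combine-injective a (lookup g a) b (lookup g′ b) e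
      ... | refl , e′ = refl , e′

  -- `ρ` compares only graphs with exactly m edges, so the blow-up is first padded with disjoint
  -- edges.
  ρ-lower : ∀ k s m {r} → k * s * s ≤ m → ρ[ C k , m ]≡ r → s ^ k ≤ r
  ρ-lower k s m ks²≤m ρ≡r =
    let ≤m = ≤-trans (∣E-blowup∣ k s) ks²≤m
        (_ , G , E≡ , tr) = addEdges (m ∸ ∣E blowup k s ∣) (blowup k s) (blowup-transversals k s)
    in ≤-trans (transversals-≤ G tr) (ρ[_,_]≡_.upperBound ρ≡r G (trans E≡ (m∸n+n≡m ≤m)))

  nonTrivial⇒≥2+ : ∀ l .{{_ : NonTrivial l}} → ∃[ j ] l ≡ 2 + j
  nonTrivial⇒≥2+ (suc (suc j)) = j , refl

  copies-odd-cycle-≤′ : ∀ l .{{_ : NonTrivial l}} {n} (G : SimpleGraph (Fin n)) → let k = suc (2 * l) in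
    (c G (C k) * (k + k)) ^ (2 * l) * ((l ∸ 1) ^ (l ∸ 1)) ^ k ≤ (∣E G ∣ ^ l) ^ k
  copies-odd-cycle-≤′ l G =
    let (j , l≡) = nonTrivial⇒≥2+ l in
    copies-odd-cycle-≤ G j {l} {l ∸ 1} {2 * l} l≡ (cong (_∸ 1) l≡) (*-comm 2 l)

module Radicals where

  open import Defs
  open import Data.Integer.Base using (+_; +[1+_])
  import Data.Integer.Base as ℤ
  import Data.Integer.Properties as ℤ
  import Data.Nat.Base as ℕ
  open import Data.Nat.Base using (ℕ; zero; suc; z≤n; s≤s; NonZero; NonTrivial)
    renaming (_*_ to _*ℕ_; _+_ to _+ℕ_; _^_ to infixr 8 _^ℕ_; _≤_ to _≤ℕ_; _<_ to _<ℕ_)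
  import Data.Nat.Properties as ℕ
  import Data.Nat.Solver
  open import Data.Nat.Tactic.RingSolver using () renaming (solve-∀ to solve-ℕ)
  open import Data.Product.Base using (_×_; _,_; proj₁; proj₂; ∃-syntax)
  open import Data.Rational.Base hiding (>-nonZero) renaming (NonZero to ℚNonZero)
  open import Data.Rational.Properties
  open import Data.Rational.Solver using (module +-*-Solver)
  import Data.Rational.Unnormalised.Base as ℚᵘ
  open import Data.Rational.Unnormalised.Base using (mkℚᵘ; *≡*; *≤*; *<*)
  import Data.Rational.Unnormalised.Properties as ℚᵘ
  open import Relation.Binary.PropositionalEquality
  open import Relation.Nullary.Decidable using (yes; no)
  open import Algebra.Bundles using (CommutativeRing)
  open import Algebra.Definitions.RawSemiring +-*-rawSemiring using (_^_)
  import Algebra.Properties.CommutativeSemiring.Exp (CommutativeRing.commutativeSemiring +-*-commutativeRing) as Exp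
  open Counting using (^-distribʳ-*; copies-odd-cycle-≤′; ρ-lower)

  -- Natural numbers and fractions in ℚ

  /-* : ∀ a b c d .{{_ : NonZero b}} .{{_ : NonZero d}} →
        (+ a / b) * (+ c / d) ≡ (+ (a *ℕ c) / (b *ℕ d)) {{ℕ.m*n≢0 b d}}
  /-* a (suc b) c (suc d) = toℚᵘ-injective (begin-equality
    toℚᵘ ((+ a / suc b) * (+ c / suc d))
      ≃⟨ toℚᵘ-homo-* (+ a / suc b) (+ c / suc d) ⟩
    toℚᵘ (+ a / suc b) ℚᵘ.* toℚᵘ (+ c / suc d)
      ≃⟨ ℚᵘ.*-cong (toℚᵘ-fromℚᵘ (mkℚᵘ (+ a) b)) (toℚᵘ-fromℚᵘ (mkℚᵘ (+ c) d)) ⟩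
    mkℚᵘ (+ a) b ℚᵘ.* mkℚᵘ (+ c) d
      ≡⟨ cong (λ n → mkℚᵘ n (d +ℕ b *ℕ suc d)) (sym (ℤ.pos-* a c)) ⟩
    mkℚᵘ (+ (a *ℕ c)) (d +ℕ b *ℕ suc d)
      ≃⟨ toℚᵘ-fromℚᵘ (mkℚᵘ (+ (a *ℕ c)) (d +ℕ b *ℕ suc d)) ⟨
    toℚᵘ (+ (a *ℕ c) / (suc b *ℕ suc d)) ∎)
    where open ℚᵘ.≤-Reasoning

  ι : ℕ → ℚ
  ι n = + n / 1

  ι-* : ∀ a b → ι (a *ℕ b) ≡ ι a * ι b
  ι-* a b = sym (/-* a 1 b 1)

  ι-^ : ∀ a n → ι (a ^ℕ n) ≡ ι a ^ n
  ι-^ a zero    = refl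
  ι-^ a (suc n) = trans (ι-* a (a ^ℕ n)) (cong (ι a *_) (ι-^ a n))

  ι-mono : ∀ {a b} → a ≤ℕ b → ι a ≤ ι b
  ι-mono {a} {b} a≤b = toℚᵘ-cancel-≤ (ℚᵘ.≤-respʳ-≃ (ℚᵘ.≃-sym (toℚᵘ-fromℚᵘ (mkℚᵘ (+ b) 0)))
    (ℚᵘ.≤-respˡ-≃ (ℚᵘ.≃-sym (toℚᵘ-fromℚᵘ (mkℚᵘ (+ a) 0)))
      (*≤* (ℤ.*-monoʳ-≤-nonNeg (+ 1) (ℤ.+≤+ a≤b)))))

  ι-nonNeg : ∀ n → NonNegative (ι n)
  ι-nonNeg n = normalize-nonNeg n 1

  ι-pos : ∀ n .{{_ : NonZero n}} → Positive (ι n)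
  ι-pos n = normalize-pos n 1

  /*ι : ∀ m n .{{_ : NonZero n}} → (+ m / n) * ι n ≡ ι m
  /*ι m n@(suc n-1) = trans (/-* m n n 1)
    (fromℚᵘ-cong {mkℚᵘ (+ (m *ℕ n)) (n-1 *ℕ 1)} {mkℚᵘ (+ m) 0}
      (*≡* (trans (sym (ℤ.pos-* (m *ℕ n) 1)) (trans (cong +_ (eq m n)) (ℤ.pos-* m (n *ℕ 1))))))
    where
    eq : ∀ m n → m *ℕ n *ℕ 1 ≡ m *ℕ (n *ℕ 1)
    eq = solve-ℕ

  -- The upper bound as an inequality of radicals

  radical-upper-ℕ : ∀ r k m t l L I J → k ≡ suc L → L ≡ 2 *ℕ l → I ≡ L → J ≡ 2 *ℕ L → .{{_ : NonZero l}} →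
    (r *ℕ (k +ℕ k)) ^ℕ L *ℕ (t ^ℕ t) ^ℕ k ≤ℕ (m ^ℕ l) ^ℕ k →
    r ^ℕ (J *ℕ 2) *ℕ (((2 ^ℕ I *ℕ t ^ℕ (t *ℕ k)) ^ℕ 2) ^ℕ 2 *ℕ (k ^ℕ k) ^ℕ J)
      ≤ℕ ((k ^ℕ (L ℕ.∸ 1)) ^ℕ I) ^ℕ 2 *ℕ (m ^ℕ k) ^ℕ J
  radical-upper-ℕ r k m t l@(suc l′) L .L .(2 *ℕ L) k≡ L≡ refl refl hyp = begin
    r ^ℕ (2 *ℕ L *ℕ 2) *ℕ ((D ^ℕ 2) ^ℕ 2 *ℕ (k ^ℕ k) ^ℕ (2 *ℕ L))
      ≡⟨ cong₂ (λ x y → x *ℕ ((D ^ℕ 2) ^ℕ 2 *ℕ y)) r-power k-power ⟩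
    (r ^ℕ L) ^ℕ 4 *ℕ ((D ^ℕ 2) ^ℕ 2 *ℕ (K *ℕ (k ^ℕ L) ^ℕ 4))
      ≡⟨ regroup (r ^ℕ L) D (k ^ℕ L) K ⟩
    K *ℕ (r ^ℕ L *ℕ k ^ℕ L *ℕ D) ^ℕ 4
      ≡⟨ cong (λ x → K *ℕ x ^ℕ 4) hyp-left ⟨
    K *ℕ ((r *ℕ (k +ℕ k)) ^ℕ L *ℕ (t ^ℕ t) ^ℕ k) ^ℕ 4
      ≤⟨ ℕ.*-monoʳ-≤ K (ℕ.^-monoˡ-≤ 4 hyp) ⟩
    K *ℕ ((m ^ℕ l) ^ℕ k) ^ℕ 4
      ≡⟨ cong (K *ℕ_) m-power ⟩
    K *ℕ (m ^ℕ k) ^ℕ (2 *ℕ L) ∎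
    where
    open ℕ.≤-Reasoning
    D = 2 ^ℕ L *ℕ t ^ℕ (t *ℕ k)
    -- The numerator of the constant contributes `K`. Since k^(2Lk) = K k^(4L), the claim is the
    -- fourth power of `hyp` multiplied by `K`.
    K = ((k ^ℕ (L ℕ.∸ 1)) ^ℕ L) ^ℕ 2
    assoc₃ : ∀ x a b c → ((x ^ℕ a) ^ℕ b) ^ℕ c ≡ x ^ℕ (a *ℕ b *ℕ c)
    assoc₃ x a b c = trans (cong (_^ℕ c) (ℕ.^-*-assoc x a b)) (ℕ.^-*-assoc x (a *ℕ b) c)
    r-power : r ^ℕ (2 *ℕ L *ℕ 2) ≡ (r ^ℕ L) ^ℕ 4
    r-power = trans (cong (r ^ℕ_) (eq L)) (sym (ℕ.^-*-assoc r L 4))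
      where
      eq : ∀ L → 2 *ℕ L *ℕ 2 ≡ L *ℕ 4
      eq = solve-ℕ
    m-power : ((m ^ℕ l) ^ℕ k) ^ℕ 4 ≡ (m ^ℕ k) ^ℕ (2 *ℕ L)
    m-power = trans (assoc₃ m l k 4)
      (trans (cong (m ^ℕ_) (trans (eq l k) (cong (λ L → k *ℕ (2 *ℕ L)) (sym L≡)))) (sym (ℕ.^-*-assoc m k (2 *ℕ L))))
      where
      eq : ∀ l k → l *ℕ k *ℕ 4 ≡ k *ℕ (2 *ℕ (2 *ℕ l))
      eq = solve-ℕ
    -- `L` is positive, so `L ∸ 1` is a true predecessor; the exponent identity (L+1) 2L = 2(L-1)L +
    -- 4L relies on this.
    L≡1+ : L ≡ suc (2 *ℕ l′ +ℕ 1)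
    L≡1+ = trans L≡ (eq l′)
      where
      eq : ∀ l → 2 *ℕ suc l ≡ suc (2 *ℕ l +ℕ 1)
      eq = solve-ℕ
    k-power : (k ^ℕ k) ^ℕ (2 *ℕ L) ≡ K *ℕ (k ^ℕ L) ^ℕ 4
    k-power = trans (ℕ.^-*-assoc k k (2 *ℕ L)) (trans (cong (k ^ℕ_) (trans (cong (_*ℕ (2 *ℕ L)) k≡) (exponents L L≡1+)))
      (trans (ℕ.^-distribˡ-+-* k ((L ℕ.∸ 1) *ℕ L *ℕ 2) (L *ℕ 4))
        (cong₂ _*ℕ_ (sym (assoc₃ k (L ℕ.∸ 1) L 2)) (sym (ℕ.^-*-assoc k L 4)))))
      where
      exponents : ∀ L {p} → L ≡ suc p → suc L *ℕ (2 *ℕ L) ≡ (L ℕ.∸ 1) *ℕ L *ℕ 2 +ℕ L *ℕ 4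
      exponents .(suc p) {p} refl = eq p
        where
        eq : ∀ p → suc (suc p) *ℕ (2 *ℕ suc p) ≡ p *ℕ suc p *ℕ 2 +ℕ suc p *ℕ 4
        eq = solve-ℕ
    hyp-left : (r *ℕ (k +ℕ k)) ^ℕ L *ℕ (t ^ℕ t) ^ℕ k ≡ r ^ℕ L *ℕ k ^ℕ L *ℕ D
    hyp-left = trans (cong₂ _*ℕ_
      (trans (^-distribʳ-* L r (k +ℕ k)) (cong (r ^ℕ L *ℕ_) (trans (cong (_^ℕ L) (eq k)) (^-distribʳ-* L 2 k))))
      (ℕ.^-*-assoc t t k)) (eq′ (r ^ℕ L) (2 ^ℕ L) (k ^ℕ L) _)
      where
      eq : ∀ k → k +ℕ k ≡ 2 *ℕ k
      eq = solve-ℕ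
      eq′ : ∀ a b c d → a *ℕ (b *ℕ c) *ℕ d ≡ a *ℕ c *ℕ (b *ℕ d)
      eq′ = solve-ℕ
    regroup : ∀ a D b K → a ^ℕ 4 *ℕ ((D ^ℕ 2) ^ℕ 2 *ℕ (K *ℕ b ^ℕ 4)) ≡ K *ℕ (a *ℕ b *ℕ D) ^ℕ 4
    regroup = solve 4 (λ a D b K → a :^ 4 :* ((D :^ 2) :^ 2 :* (K :* b :^ 4)) := K :* (a :* b :* D) :^ 4) refl
      where open Data.Nat.Solver.+-*-Solver using (solve; _:*_; _:=_; _:^_)

  -- The shape to which `≤ᴿ` unfolds. `I`, `I′` and `J` are the indices of `power`,
  -- `natural 2 · power` and `upperConstant`, which the definitions leave as products with 1; hence
  -- variables tied by equations. `x` is the reciprocal of the divisor in the constant and `y` is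
  -- m/k; multiplication by a positive `Z` clears both denominators.
  radical-upper : ∀ r k m t l L I I′ J (x y : ℚ) → .{{_ : NonZero k}} .{{_ : NonZero l}} →
    k ≡ suc L → L ≡ 2 *ℕ l → I ≡ L → I′ ≡ I → J ≡ 2 *ℕ L →
    (d>0 : Positive (ι 2 ^ I * (ι t ^ (t *ℕ k)) ^ 1)) →
    x * (ι 2 ^ I * (ι t ^ (t *ℕ k)) ^ 1) ≡ 1ℚ → y * ι k ≡ ι m →
    (r *ℕ (k +ℕ k)) ^ℕ L *ℕ (t ^ℕ t) ^ℕ k ≤ℕ (m ^ℕ l) ^ℕ k →
    ι r ^ (J *ℕ 2) ≤ (((ι k ^ (L ℕ.∸ 1)) ^ I′ * x ^ 2) ^ 2 * (y ^ k) ^ J) ^ 1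
  radical-upper r k m t l L I .I J x y k≡ L≡ I≡ refl J≡ d>0 xd≡1 yk≡m hyp =
    *-cancelʳ-≤-pos Z {{Z>0}} (begin
      ι r ^ (J *ℕ 2) * Z                             ≡⟨ left ⟩
      ι (r ^ℕ (J *ℕ 2) *ℕ (((2 ^ℕ I *ℕ t ^ℕ (t *ℕ k)) ^ℕ 2) ^ℕ 2 *ℕ (k ^ℕ k) ^ℕ J))
        ≤⟨ ι-mono (radical-upper-ℕ r k m t l L I J k≡ L≡ I≡ J≡ hyp) ⟩
      ι (((k ^ℕ (L ℕ.∸ 1)) ^ℕ I) ^ℕ 2 *ℕ (m ^ℕ k) ^ℕ J)
        ≡⟨ right ⟩
      ((A * x ^ 2) ^ 2 * (y ^ k) ^ J) ^ 1 * Z         ∎)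
    where
    open ≤-Reasoning
    d = ι 2 ^ I * (ι t ^ (t *ℕ k)) ^ 1
    A = (ι k ^ (L ℕ.∸ 1)) ^ I
    Z = (d ^ 2) ^ 2 * (ι k ^ k) ^ J
    Z>0 : Positive Z
    Z>0 = pos*pos⇒pos ((d ^ 2) ^ 2) {{^-pos (d ^ 2) {{^-pos d {{d>0}} 2}} 2}} ((ι k ^ k) ^ J)
            {{^-pos (ι k ^ k) {{^-pos (ι k) {{ι-pos k}} k}} J}}
    ι-d : ι (2 ^ℕ I *ℕ t ^ℕ (t *ℕ k)) ≡ d
    ι-d = trans (ι-* (2 ^ℕ I) _) (cong₂ _*_ (ι-^ 2 I) (trans (ι-^ t (t *ℕ k)) (sym (*-identityʳ _))))
    ι-^^ : ∀ a b c → ι ((a ^ℕ b) ^ℕ c) ≡ (ι a ^ b) ^ c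
    ι-^^ a b c = trans (ι-^ (a ^ℕ b) c) (cong (_^ c) (ι-^ a b))
    left : ι r ^ (J *ℕ 2) * Z ≡ ι (r ^ℕ (J *ℕ 2) *ℕ (((2 ^ℕ I *ℕ t ^ℕ (t *ℕ k)) ^ℕ 2) ^ℕ 2 *ℕ (k ^ℕ k) ^ℕ J))
    left = sym (trans (ι-* (r ^ℕ (J *ℕ 2)) _) (cong₂ _*_ (ι-^ r (J *ℕ 2))
      (trans (ι-* (((2 ^ℕ I *ℕ t ^ℕ (t *ℕ k)) ^ℕ 2) ^ℕ 2) _) (cong₂ _*_
        (trans (ι-^^ (2 ^ℕ I *ℕ t ^ℕ (t *ℕ k)) 2 2) (cong (λ z → (z ^ 2) ^ 2) ι-d))
        (ι-^^ k k J)))))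
    right : ι (((k ^ℕ (L ℕ.∸ 1)) ^ℕ I) ^ℕ 2 *ℕ (m ^ℕ k) ^ℕ J) ≡ ((A * x ^ 2) ^ 2 * (y ^ k) ^ J) ^ 1 * Z
    right = ≡-R.begin
      ι (((k ^ℕ (L ℕ.∸ 1)) ^ℕ I) ^ℕ 2 *ℕ (m ^ℕ k) ^ℕ J)
        ≡-R.≡⟨ ι-* (((k ^ℕ (L ℕ.∸ 1)) ^ℕ I) ^ℕ 2) _ ⟩
      ι (((k ^ℕ (L ℕ.∸ 1)) ^ℕ I) ^ℕ 2) * ι ((m ^ℕ k) ^ℕ J)
        ≡-R.≡⟨ cong₂ _*_ (trans (ι-^ ((k ^ℕ (L ℕ.∸ 1)) ^ℕ I) 2) (cong (_^ 2) (ι-^^ k (L ℕ.∸ 1) I)))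
                    (trans (ι-^^ m k J) (cong (λ z → (z ^ k) ^ J) (sym yk≡m))) ⟩
      A ^ 2 * ((y * ι k) ^ k) ^ J
        ≡-R.≡⟨ cong (A ^ 2 *_) (trans (cong (_^ J) (Exp.^-distrib-* y (ι k) k)) (Exp.^-distrib-* (y ^ k) (ι k ^ k) J)) ⟩
      A ^ 2 * ((y ^ k) ^ J * (ι k ^ k) ^ J)
        ≡-R.≡⟨ cong (λ z → A ^ 2 * z) (*-identityˡ ((y ^ k) ^ J * (ι k ^ k) ^ J)) ⟨
      A ^ 2 * ((1ℚ ^ 2) ^ 2 * ((y ^ k) ^ J * (ι k ^ k) ^ J))
        ≡-R.≡⟨ cong (λ z → A ^ 2 * ((z ^ 2) ^ 2 * ((y ^ k) ^ J * (ι k ^ k) ^ J))) xd≡1 ⟨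
      A ^ 2 * (((x * d) ^ 2) ^ 2 * ((y ^ k) ^ J * (ι k ^ k) ^ J))
        ≡-R.≡⟨ eq A x d ((y ^ k) ^ J) ((ι k ^ k) ^ J) ⟩
      ((A * x ^ 2) ^ 2 * (y ^ k) ^ J) ^ 1 * Z ≡-R.∎
      where
      module ≡-R = ≡-Reasoning
      eq : ∀ A x d B C → A ^ 2 * (((x * d) ^ 2) ^ 2 * (B * C)) ≡ ((A * x ^ 2) ^ 2 * B) ^ 1 * ((d ^ 2) ^ 2 * C)
      open +-*-Solver using (solve; _:*_; _:=_; _:^_)
      eq = solve 5 (λ A x d B C → A :^ 2 :* (((x :* d) :^ 2) :^ 2 :* (B :* C)) :=
                                     ((A :* x :^ 2) :^ 2 :* B) :^ 1 :* ((d :^ 2) :^ 2 :* C)) refl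

  upper-bound : ∀ l .{{_ : NonTrivial l}} m {r} → ρ[ C (suc (2 *ℕ l)) , m ]≡ r →
    natural r ≤ᴿ upperConstant l · mainTerm l m
  upper-bound l m {r} ρ≡r =
    radical-upper r k m (l ℕ.∸ 1) l L (1 *ℕ L) (1 *ℕ (1 *ℕ L)) (2 *ℕ (1 *ℕ (1 *ℕ L))) (1/ d) (+ m / k) {{_}} {{l≢0}}
      refl refl (ℕ.*-identityˡ L) (ℕ.*-identityˡ (1 *ℕ L)) (cong (2 *ℕ_) (trans (ℕ.*-identityˡ (1 *ℕ L)) (ℕ.*-identityˡ L)))
      d>0 (*-inverseˡ d) (/*ι m k) hyp
    where
    Bound : ℕ → ℕ → Set
    Bound r m = let k = suc (2 *ℕ l) in
      (r *ℕ (k +ℕ k)) ^ℕ (2 *ℕ l) *ℕ ((l ℕ.∸ 1) ^ℕ (l ℕ.∸ 1)) ^ℕ k ≤ℕ (m ^ℕ l) ^ℕ k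
    hyp : Bound r m
    hyp = let (n , G , E≡m , c≡r) = ρ[_,_]≡_.attained ρ≡r in
      subst₂ Bound c≡r E≡m (copies-odd-cycle-≤′ l G)
    L = 2 *ℕ l
    k = suc L
    d = ι 2 ^ (1 *ℕ L) * (ι (l ℕ.∸ 1) ^ ((l ℕ.∸ 1) *ℕ k)) ^ 1
    l≢0 : NonZero l
    l≢0 = ℕ.nonTrivial⇒nonZero l
    l-1≢0 : ∀ l .{{_ : NonTrivial l}} → NonZero (l ℕ.∸ 1)
    l-1≢0 (suc (suc _)) = _
    d>0 : Positive d
    d>0 = pos*pos⇒pos (ι 2 ^ (1 *ℕ L)) {{^-pos (ι 2) (1 *ℕ L)}} _
      {{^-pos (ι (l ℕ.∸ 1) ^ ((l ℕ.∸ 1) *ℕ k)) {{^-pos (ι (l ℕ.∸ 1)) {{ι-pos (l ℕ.∸ 1) {{l-1≢0 l}}}} ((l ℕ.∸ 1) *ℕ k)}} 1}}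
    instance
      d≢0 : ℚNonZero d
      d≢0 = pos⇒nonZero d {{d>0}}

  -- The lower bound as an inequality of radicals, and the convergence of `δ`

  ι-+ : ∀ a b → ι (a +ℕ b) ≡ ι a + ι b
  ι-+ a b = toℚᵘ-injective (begin-equality
    toℚᵘ (ι (a +ℕ b))
      ≃⟨ toℚᵘ-fromℚᵘ (mkℚᵘ (+ (a +ℕ b)) 0) ⟩
    mkℚᵘ (+ (a +ℕ b)) 0
      ≡⟨ cong (λ n → mkℚᵘ n 0) (cong₂ ℤ._+_ (ℤ.*-identityʳ (+ a)) (ℤ.*-identityʳ (+ b))) ⟨
    mkℚᵘ (+ a) 0 ℚᵘ.+ mkℚᵘ (+ b) 0
      ≃⟨ ℚᵘ.+-cong (toℚᵘ-fromℚᵘ (mkℚᵘ (+ a) 0)) (toℚᵘ-fromℚᵘ (mkℚᵘ (+ b) 0)) ⟨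
    toℚᵘ (ι a) ℚᵘ.+ toℚᵘ (ι b)
      ≃⟨ toℚᵘ-homo-+ (ι a) (ι b) ⟨
    toℚᵘ (ι a + ι b) ∎)
    where open ℚᵘ.≤-Reasoning

  ι-mono-< : ∀ {a b} → a <ℕ b → ι a < ι b
  ι-mono-< {a} {b} a<b = toℚᵘ-cancel-< (ℚᵘ.<-respʳ-≃ (ℚᵘ.≃-sym (toℚᵘ-fromℚᵘ (mkℚᵘ (+ b) 0)))
    (ℚᵘ.<-respˡ-≃ (ℚᵘ.≃-sym (toℚᵘ-fromℚᵘ (mkℚᵘ (+ a) 0)))
      (*<* (ℤ.*-monoʳ-<-pos (+ 1) (ℤ.+<+ a<b)))))

  ^-mono-≤ : ∀ n {p q} .{{_ : NonNegative p}} → p ≤ q → p ^ n ≤ q ^ n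
  ^-mono-≤ zero    p≤q = ≤-refl
  ^-mono-≤ (suc n) {p} {q} p≤q = ≤-trans
    (*-monoˡ-≤-nonNeg p (^-mono-≤ n p≤q))
    (*-monoʳ-≤-nonNeg (q ^ n) {{^-nonNeg q {{nonNegative (≤-trans (nonNegative⁻¹ p) p≤q)}} n}} p≤q)

  -- sqrt/ k m = ⌊√(m/k)⌋
  sqrt/ : ℕ → ℕ → ℕ
  sqrt/ k zero    = 0
  sqrt/ k (suc m) with k *ℕ suc (sqrt/ k m) *ℕ suc (sqrt/ k m) ℕ.≤? suc m
  ... | yes _ = suc (sqrt/ k m)
  ... | no  _ = sqrt/ k m

  sqrt/-bounds : ∀ k .{{_ : NonZero k}} m → let s = sqrt/ k m in k *ℕ s *ℕ s ≤ℕ m × m <ℕ k *ℕ suc s *ℕ suc s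
  sqrt/-bounds k zero = ℕ.≤-reflexive (ℕ.*-zeroʳ (k *ℕ 0)) , ℕ.>-nonZero⁻¹ _ {{ℕ.m*n≢0 (k *ℕ 1) 1 {{ℕ.m*n≢0 k 1}}}}
  sqrt/-bounds k (suc m) with k *ℕ suc (sqrt/ k m) *ℕ suc (sqrt/ k m) ℕ.≤? suc m | sqrt/-bounds k m
  -- The root grows by at most one: m < k(s+1)² means m + 1 ≤ k(s+1)², which is below k(s+2)².
  ... | yes ≤m | _ , m< = ≤m , ℕ.≤-<-trans m< (ℕ.<-≤-trans
        (ℕ.*-monoʳ-< (k *ℕ suc s) {{ℕ.m*n≢0 k (suc s)}} (ℕ.n<1+n (suc s)))
        (ℕ.*-monoˡ-≤ (suc (suc s)) (ℕ.*-monoʳ-≤ k (ℕ.n≤1+n (suc s)))))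
    where s = sqrt/ k m
  ... | no  ≰m | ≤m , _ = ℕ.≤-trans ≤m (ℕ.n≤1+n m) , ℕ.≰⇒> ≰m

  sqrt/-unbounded : ∀ k .{{_ : NonZero k}} e m → k *ℕ e *ℕ e ≤ℕ m → e ≤ℕ sqrt/ k m
  sqrt/-unbounded k e m ke²≤m = ℕ.≮⇒≥ λ s<e → ℕ.<-irrefl refl (ℕ.<-≤-trans (proj₂ (sqrt/-bounds k m))
    (ℕ.≤-trans (ℕ.*-mono-≤ (ℕ.*-monoʳ-≤ k s<e) s<e) ke²≤m))

  -- A rational lower estimate of s / √(m/k), as √(m/k) < s + 1. Its k-th power is the loss against
  -- the main term.
  ratio : ℕ → ℚ
  ratio s = + s / suc s

  ratio-nonNeg : ∀ s → NonNegative (ratio s)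
  ratio-nonNeg s = normalize-nonNeg s (suc s)

  ratio-complement : ∀ s → ratio s + (+ 1 / suc s) ≡ 1ℚ
  ratio-complement s = *-cancelʳ-pos (ι (suc s)) {{ι-pos (suc s)}} (begin
    (ratio s + (+ 1 / suc s)) * ι (suc s)             ≡⟨ *-distribʳ-+ (ι (suc s)) (ratio s) _ ⟩
    ratio s * ι (suc s) + (+ 1 / suc s) * ι (suc s)   ≡⟨ cong₂ _+_ (/*ι s (suc s)) (/*ι 1 (suc s)) ⟩
    ι s + ι 1                                         ≡⟨ +-comm (ι s) (ι 1) ⟩
    ι 1 + ι s                                         ≡⟨ ι-+ 1 s ⟨
    ι (suc s)                                         ≡⟨ *-identityˡ (ι (suc s)) ⟨
    1ℚ * ι (suc s)                                    ∎)
    where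
    open ≡-Reasoning
    *-cancelʳ-pos : ∀ r .{{_ : Positive r}} {p q} → p * r ≡ q * r → p ≡ q
    *-cancelʳ-pos r e = ≤-antisym (*-cancelʳ-≤-pos r (≤-reflexive e)) (*-cancelʳ-≤-pos r (≤-reflexive (sym e)))

  ratio≤1 : ∀ s → ratio s ≤ 1ℚ
  ratio≤1 s = *-cancelʳ-≤-pos (ι (suc s)) {{ι-pos (suc s)}} (begin
    ratio s * ι (suc s)  ≡⟨ /*ι s (suc s) ⟩
    ι s                  ≤⟨ ι-mono (ℕ.n≤1+n s) ⟩
    ι (suc s)            ≡⟨ *-identityˡ (ι (suc s)) ⟨
    1ℚ * ι (suc s)       ∎)
    where open ≤-Reasoning

  ratio^≤1 : ∀ s n → ratio s ^ n ≤ 1ℚ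
  ratio^≤1 s n = ≤-trans (^-mono-≤ n {{ratio-nonNeg s}} (ratio≤1 s)) (≤-reflexive (1^ n))
    where
    1^ : ∀ n → 1ℚ ^ n ≡ 1ℚ
    1^ zero    = refl
    1^ (suc n) = trans (*-identityˡ (1ℚ ^ n)) (1^ n)

  -- Write 1 = q + y with q the ratio. Multiplying the previous case by q ≤ 1 does not enlarge its
  -- error n y, and the summand y adds one more.
  bernoulli : ∀ s n → 1ℚ ≤ ratio s ^ n + ι n * (+ 1 / suc s)
  bernoulli s zero    = ≤-reflexive (sym (trans (cong (λ z → 1ℚ + z) (*-zeroˡ (+ 1 / suc s))) (+-identityʳ 1ℚ)))
  bernoulli s (suc n) = begin
    1ℚ                                ≡⟨ ratio-complement s ⟨
    q + y                             ≡⟨ cong (_+ y) (*-identityʳ q) ⟨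
    q * 1ℚ + y                        ≤⟨ +-monoˡ-≤ y (*-monoˡ-≤-nonNeg q {{ratio-nonNeg s}} (bernoulli s n)) ⟩
    q * (q ^ n + ι n * y) + y         ≡⟨ cong (_+ y) (*-distribˡ-+ q (q ^ n) (ι n * y)) ⟩
    q ^ suc n + q * (ι n * y) + y     ≤⟨ +-monoˡ-≤ y (+-monoʳ-≤ (q ^ suc n) (*-monoʳ-≤-nonNeg (ι n * y) {{ny≥0}} (ratio≤1 s))) ⟩
    q ^ suc n + 1ℚ * (ι n * y) + y    ≡⟨ +-assoc (q ^ suc n) _ y ⟩
    q ^ suc n + (1ℚ * (ι n * y) + y)  ≡⟨ cong (λ z → q ^ suc n + z) step ⟩
    q ^ suc n + ι (suc n) * y         ∎
    where
    open ≤-Reasoning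
    q = ratio s
    y = + 1 / suc s
    ny≥0 : NonNegative (ι n * y)
    ny≥0 = nonNeg*nonNeg⇒nonNeg (ι n) {{ι-nonNeg n}} y {{normalize-nonNeg 1 (suc s)}}
    step : 1ℚ * (ι n * y) + y ≡ ι (suc n) * y
    step = trans (cong₂ _+_ (*-identityˡ (ι n * y)) (sym (*-identityˡ y)))
      (trans (+-comm (ι n * y) (1ℚ * y)) (trans (sym (*-distribʳ-+ y 1ℚ (ι n))) (cong (_* y) (sym (ι-+ 1 n)))))

  ∣ratio^-1∣≤ : ∀ s n → ∣ ratio s ^ n - 1ℚ ∣ ≤ ι n * (+ 1 / suc s)
  ∣ratio^-1∣≤ s n = begin
    ∣ x - 1ℚ ∣        ≡⟨ ∣-p∣≡∣p∣ (x - 1ℚ) ⟨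
    ∣ - (x - 1ℚ) ∣    ≡⟨ 0≤p⇒∣p∣≡p (≤-trans (≤-reflexive refl) (neg-antimono-≤ x-1≤0)) ⟩
    - (x - 1ℚ)        ≡⟨ trans (neg-distrib-+ x (- 1ℚ)) (+-comm (- x) 1ℚ) ⟩
    1ℚ - x            ≤⟨ +-monoˡ-≤ (- x) (bernoulli s n) ⟩
    x + b - x         ≡⟨ trans (cong (_+ - x) (+-comm x b))
                           (trans (+-assoc b x (- x)) (trans (cong (λ z → b + z) (+-inverseʳ x)) (+-identityʳ b))) ⟩
    b                 ∎
    where
    open ≤-Reasoning
    x = ratio s ^ n
    b = ι n * (+ 1 / suc s)
    x-1≤0 : x - 1ℚ ≤ 0ℚ
    x-1≤0 = +-monoˡ-≤ (- 1ℚ) (ratio^≤1 s n)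

  -- A positive ε with denominator d is at least 1/d, and k/(s+1) < 1/d as soon as s ≥ kd.
  small-fraction : ∀ k ε → 0ℚ < ε → ∃[ e ] ∀ s → e ≤ℕ s → ι k * (+ 1 / suc s) < ε
  small-fraction k ε 0<ε = k *ℕ d , λ s kd≤s → *-cancelʳ-<-nonNeg (ι (d *ℕ suc s)) {{ι-nonNeg (d *ℕ suc s)}} (begin-strict
    ι k * (+ 1 / suc s) * ι (d *ℕ suc s)       ≡⟨ cong (ι k * (+ 1 / suc s) *_) (trans (ι-* d (suc s)) (*-comm (ι d) (ι (suc s)))) ⟩
    ι k * (+ 1 / suc s) * (ι (suc s) * ι d)    ≡⟨ *-assoc (ι k) (+ 1 / suc s) _ ⟩
    ι k * ((+ 1 / suc s) * (ι (suc s) * ι d))  ≡⟨ cong (ι k *_) (*-assoc (+ 1 / suc s) (ι (suc s)) (ι d)) ⟨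
    ι k * ((+ 1 / suc s) * ι (suc s) * ι d)    ≡⟨ cong (λ z → ι k * (z * ι d)) (/*ι 1 (suc s)) ⟩
    ι k * (1ℚ * ι d)                           ≡⟨ cong (ι k *_) (*-identityˡ (ι d)) ⟩
    ι k * ι d                                  ≡⟨ ι-* k d ⟨
    ι (k *ℕ d)                                 <⟨ ι-mono-< (s≤s kd≤s) ⟩
    ι (suc s)                                  ≡⟨ *-identityˡ (ι (suc s)) ⟨
    1ℚ * ι (suc s)                             ≤⟨ *-monoʳ-≤-nonNeg (ι (suc s)) {{ι-nonNeg (suc s)}} 1≤εd ⟩
    ε * ι d * ι (suc s)                        ≡⟨ *-assoc ε (ι d) _ ⟩
    ε * (ι d * ι (suc s))                      ≡⟨ cong (ε *_) (ι-* d (suc s)) ⟨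
    ε * ι (d *ℕ suc s)                         ∎)
    where
    open ≤-Reasoning
    d = ↧ₙ ε
    1≤ε↧ : ∀ ε → Positive ε → 1ℚ ≤ ε * ι (↧ₙ ε)
    1≤ε↧ ε@(mkℚ +[1+ a ] d-1 _) _ = ≤-trans (ι-mono {1} {suc a} (s≤s z≤n))
      (≤-reflexive (sym (trans (cong (_* ι (suc d-1)) (sym (↥p/↧p≡p ε))) (/*ι (suc a) (suc d-1)))))
    1≤εd : 1ℚ ≤ ε * ι d
    1≤εd = 1≤ε↧ ε (positive 0<ε)

  δ : ℕ → ℕ → ℚ
  δ k m = ratio (sqrt/ k m) ^ k - 1ℚ

  1+δ≡ : ∀ k m → 1ℚ + δ k m ≡ ratio (sqrt/ k m) ^ k
  1+δ≡ k m = trans (+-comm 1ℚ (x - 1ℚ)) (trans (+-assoc x (- 1ℚ) 1ℚ) (+-identityʳ x))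
    where x = ratio (sqrt/ k m) ^ k

  1+δ-nonNeg : ∀ k m → NonNegative (1ℚ + δ k m)
  1+δ-nonNeg k m = subst NonNegative (sym (1+δ≡ k m)) (^-nonNeg (ratio (sqrt/ k m)) {{ratio-nonNeg (sqrt/ k m)}} k)

  δ⟶0 : ∀ k .{{_ : NonZero k}} → δ k ⟶0
  δ⟶0 k ε 0<ε =
    let (e , small) = small-fraction k ε 0<ε
    in k *ℕ e *ℕ e , λ m m≥ → ≤-<-trans (∣ratio^-1∣≤ (sqrt/ k m) k) (small (sqrt/ k m) (sqrt/-unbounded k e m m≥))

  -- Since m/k ≤ (s+1)², the product (s/(s+1))² (m/k) is at most s². Its k-th power is the claim
  -- squared, which removes the root from the exponent k/2.
  radical-lower : ∀ k s m r .{{_ : NonZero k}} → m <ℕ k *ℕ suc s *ℕ suc s → s ^ℕ k ≤ℕ r →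
    ((ratio s ^ k) ^ 2 * ((+ m / k) ^ k) ^ 1) ^ 1 ≤ ι r ^ 2
  radical-lower k s m r m< sᵏ≤r = begin
    (((q ^ k) ^ 2) * (M ^ k) ^ 1) ^ 1   ≡⟨ trans (*-identityʳ _) (cong₂ _*_ (square q) (*-identityʳ (M ^ k))) ⟩
    (q ^ 2) ^ k * M ^ k                 ≡⟨ Exp.^-distrib-* (q ^ 2) M k ⟨
    (q ^ 2 * M) ^ k                     ≤⟨ ^-mono-≤ k {{q²M≥0}} base ⟩
    (ι s ^ 2) ^ k                       ≡⟨ square (ι s) ⟨
    (ι s ^ k) ^ 2                       ≤⟨ ^-mono-≤ 2 {{^-nonNeg (ι s) {{ι-nonNeg s}} k}} (≤-trans (≤-reflexive (sym (ι-^ s k))) (ι-mono sᵏ≤r)) ⟩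
    ι r ^ 2                             ∎
    where
    open ≤-Reasoning
    q = ratio s
    M = + m / k
    q²M≥0 : NonNegative (q ^ 2 * M)
    q²M≥0 = nonNeg*nonNeg⇒nonNeg (q ^ 2) {{^-nonNeg q {{ratio-nonNeg s}} 2}} M {{normalize-nonNeg m k}}
    square : ∀ x → (x ^ k) ^ 2 ≡ (x ^ 2) ^ k
    square x = trans (Exp.^-assocʳ x k 2) (trans (cong (x ^_) (ℕ.*-comm k 2)) (sym (Exp.^-assocʳ x 2 k)))
    M≤ : M ≤ ι (suc s) ^ 2
    M≤ = *-cancelʳ-≤-pos (ι k) {{ι-pos k}} (begin
      M * ι k                      ≡⟨ /*ι m k ⟩
      ι m                          ≤⟨ ι-mono (ℕ.≤-trans (ℕ.<⇒≤ m<) (ℕ.≤-reflexive (eq k (suc s)))) ⟩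
      ι (suc s *ℕ suc s *ℕ k)      ≡⟨ ι-* (suc s *ℕ suc s) k ⟩
      ι (suc s *ℕ suc s) * ι k     ≡⟨ cong (_* ι k) (trans (ι-* (suc s) (suc s)) (cong (ι (suc s) *_) (sym (*-identityʳ (ι (suc s)))))) ⟩
      ι (suc s) ^ 2 * ι k          ∎)
      where
      eq : ∀ k t → k *ℕ t *ℕ t ≡ t *ℕ t *ℕ k
      eq = solve-ℕ
    base : q ^ 2 * M ≤ ι s ^ 2
    base = begin
      q ^ 2 * M                ≤⟨ *-monoˡ-≤-nonNeg (q ^ 2) {{^-nonNeg q {{ratio-nonNeg s}} 2}} M≤ ⟩
      q ^ 2 * ι (suc s) ^ 2    ≡⟨ Exp.^-distrib-* q (ι (suc s)) 2 ⟨
      (q * ι (suc s)) ^ 2      ≡⟨ cong (_^ 2) (/*ι s (suc s)) ⟩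
      ι s ^ 2                  ∎

  lower-bound : ∀ l m {r} → let k = suc (2 *ℕ l) in ρ[ C k , m ]≡ r →
    rational (1ℚ + δ k m) {{1+δ-nonNeg k m}} · mainTerm l m ≤ᴿ natural r
  lower-bound l m {r} ρ≡r =
    subst (λ x → (x ^ 2 * ((+ m / k) ^ k) ^ 1) ^ 1 ≤ ι r ^ 2) (sym (1+δ≡ k m))
      (radical-lower k s m r (proj₂ (sqrt/-bounds k m)) (ρ-lower k s m (proj₁ (sqrt/-bounds k m)) ρ≡r))
    where
    k = suc (2 *ℕ l)
    s = sqrt/ k m

open import Defs
open import Data.Nat.Base using (ℕ; suc; NonZero; NonTrivial) renaming (_*_ to _*ℕ_)
open import Data.Product.Base using (Σ-syntax; _×_)
open import Data.Rational.Base using (ℚ; NonNegative; 1ℚ; _+_)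
open import Data.Product.Base using (_,_)
open Radicals using (lower-bound; upper-bound; 1+δ-nonNeg; δ; δ⟶0)

theorem1p7 : (l : ℕ) .{{_ : NonTrivial l}} →
    (Σ[ δ ∈ (ℕ → ℚ) ] Σ[ 1+δ≥0 ∈ (∀ m → NonNegative (1ℚ + δ m)) ]
    (δ ⟶0) ×
    (∀ m .{{_ : NonZero m}} {r} → ρ[ C (suc (2 *ℕ l)) , m ]≡ r →
    rational (1ℚ + δ m) {{1+δ≥0 m}} · mainTerm l m ≤ᴿ natural r))
    × (∀ m .{{_ : NonZero m}} {r} → ρ[ C (suc (2 *ℕ l)) , m ]≡ r →
    natural r ≤ᴿ upperConstant l · mainTerm l m)
theorem1p7 l =
  (δ (suc (2 *ℕ l)) , 1+δ-nonNeg (suc (2 *ℕ l)) , δ⟶0 (suc (2 *ℕ l)) , λ m → lower-bound l m) , λ m → upper-bound l m
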